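{- Let $n \ge 1$ and let $f(Z) \in \mathbb{C}[Z]$ be a psd-stable polynomial on the space of complex symmetric $n \times n$ matrices $Z$. Then the polynomial $$\det(Z)^{\deg(f)} \cdot f(-Z^{ -1})$$ is psd-stable.
   Context: $\mathcal{S}_n^{\mathbb{C}}$ denotes the space of complex symmetric (not Hermitian) $n\times n$ matrices. $\mathbb{C}[Z]$ denotes the ring of polynomials in the entries $z_{ij}$ of a symmetric $n\times n$ variable matrix $Z=(z_{ij})$, where $z_{ij}$ and $z_{ji}$ are identified; equivalently, the polynomial ring $\mathbb{C}[\{z_{ij} : 1\le i\le j\le n\}]$. $\deg(f)$ is the total degree. $\mathrm{Im}(M)$ is the entrywise imaginary part of a matrix $M$. A polynomial $f\in\mathbb{C}[Z]$ is called psd-stable if $f(M)\neq 0$ for every $M\in\mathcal{S}_n^{\mathbb{C}}$ such that $\mathrm{Im}(M)$ is positive definite. The factor $\det(Z)^{\deg(f)}$ serves to make the displayed expression a polynomial. -}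

module Defs where

open import Algebra.Apartness.Structures using (IsHeytingField)
open import Algebra.Bundles.Raw using (RawRing)
open import Algebra.Core using (Op₁; Op₂)
import Algebra.Definitions.RawSemiring as RawSemiringDefinitions
open import Data.Bool.Base using (if_then_else_)
open import Data.Fin.Base using (zero; suc; toℕ; punchIn)
open import Data.List.Base using (List; []; _∷_; foldr)
open import Data.Nat.Base as ℕ using (ℕ; zero; suc)
import Data.Nat.Properties as ℕ
open import Data.Product.Base using (_×_; _,_; ∃-syntax; proj₂)
open import Data.Sum.Base using (_⊎_)
open import Data.Vec.Base as Vec using (Vec)
open import Data.Vec.Functional using (Vector; head; tail; map; _++_)
open import Data.Vec.Properties using (≡-dec)
open import Level using (Level; _⊔_) renaming (suc to lsuc)
open import Relation.Binary.Core using (Rel)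
open import Relation.Binary.PropositionalEquality.Core using (_≡_)
open import Relation.Binary.Structures using (IsStrictPartialOrder)
open import Relation.Nullary.Decidable.Core using (does)
open import Relation.Nullary.Negation.Core using (¬_)

-- The field of real numbers, axiomatised as a Cauchy-complete Archimedean
-- ordered field.  Classically this determines ℝ up to isomorphism, and x # y
-- is just x ≠ y.  The order is not assumed decidable, so that constructive
-- reals are an instance as well.
record Reals (c ℓ₁ ℓ₂ : Level) : Set (lsuc (c ⊔ ℓ₁ ⊔ ℓ₂)) where
  infix  8 -_
  infixl 7 _*_
  infixl 6 _+_ _-_
  infix  4 _≈_ _<_ _#_
  field
    Carrier : Set c
    _≈_     : Rel Carrier ℓ₁
    _<_     : Rel Carrier ℓ₂
    _+_     : Op₂ Carrier
    _*_     : Op₂ Carrier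
    -_      : Op₁ Carrier
    0#      : Carrier
    1#      : Carrier

  rawRing : RawRing c ℓ₁
  rawRing = record
    { _≈_ = _≈_ ; _+_ = _+_ ; _*_ = _*_ ; -_ = -_ ; 0# = 0# ; 1# = 1# }

  _#_ : Rel Carrier ℓ₂
  x # y = x < y ⊎ y < x

  _-_ : Op₂ Carrier
  x - y = x + (- y)

  open RawSemiringDefinitions (RawRing.rawSemiring rawRing)
    using () renaming (_×_ to _·_)

  CauchySequence : (ℕ → Carrier) → Set (c ⊔ ℓ₂)
  CauchySequence s = ∀ ε → 0# < ε →
    ∃[ N ] (∀ m n → N ℕ.≤ m → N ℕ.≤ n → s m - s n < ε)

  ConvergesTo : (ℕ → Carrier) → Carrier → Set (c ⊔ ℓ₂)
  ConvergesTo s x = ∀ ε → 0# < ε →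
    ∃[ N ] (∀ n → N ℕ.≤ n → s n - x < ε × x - s n < ε)

  field
    isHeytingField       : IsHeytingField _≈_ _#_ _+_ _*_ -_ 0# 1#
    isStrictPartialOrder : IsStrictPartialOrder _≈_ _<_
    +-monoˡ-<            : ∀ {x y} z → x < y → x + z < y + z
    *-positive           : ∀ {x y} → 0# < x → 0# < y → 0# < x * y
    archimedean          : ∀ x → ∃[ n ] (x < n · 1#)
    complete             : ∀ s → CauchySequence s → ∃[ x ] ConvergesTo s x

Matrix : ∀ {a} → Set a → ℕ → Set a
Matrix A n = Vector (Vector A n) n

-- The number of pairs i ≤ j in Fin n.
triangle : ℕ → ℕ
triangle zero    = zero
triangle (suc n) = suc n ℕ.+ triangle n

-- The entries M i j with i ≤ j, row by row: coordinates on the space of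
-- symmetric matrices.
upperTriangle : ∀ {a} {A : Set a} {n} → Matrix A n → Vector A (triangle n)
upperTriangle {n = zero}  M = λ ()
upperTriangle {n = suc n} M = head M ++ upperTriangle (map tail (tail M))

module MatricesAndPolynomials {c ℓ} (R : RawRing c ℓ) where
  open RawRing R
  open RawSemiringDefinitions rawSemiring using (sum; product; _^_)

  Symmetric : ∀ {n} → Matrix Carrier n → Set ℓ
  Symmetric M = ∀ i j → M i j ≈ M j i

  identity : ∀ {n} → Matrix Carrier n
  identity zero    zero    = 1#
  identity zero    (suc j) = 0#
  identity (suc i) zero    = 0#
  identity (suc i) (suc j) = identity i j

  infixl 7 _⊗_
  _⊗_ : ∀ {n} → Matrix Carrier n → Matrix Carrier n → Matrix Carrier n
  (M ⊗ N) i k = sum (λ j → M i j * N j k)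

  negate : ∀ {n} → Matrix Carrier n → Matrix Carrier n
  negate M i j = - M i j

  Inverse : ∀ {n} → Matrix Carrier n → Matrix Carrier n → Set ℓ
  Inverse M N = (∀ i j → (M ⊗ N) i j ≈ identity i j)
              × (∀ i j → (N ⊗ M) i j ≈ identity i j)

  -- Laplace expansion along the first row.
  det : ∀ {n} → Matrix Carrier n → Carrier
  det {zero}  M = 1#
  det {suc n} M = sum λ j →
    (- 1#) ^ toℕ j * (M zero j * det (λ i k → M (suc i) (punchIn j k)))

  Exponent : ℕ → Set
  Exponent m = Vec ℕ m

  ∣_∣ : ∀ {m} → Exponent m → ℕ
  ∣ α ∣ = Vec.sum α

  -- A polynomial in m variables is a finite formal sum of terms a·x^α.  The
  -- same α may occur several times, and coefficients may vanish; the actual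
  -- coefficient of x^α is given by coefficient.
  Polynomial : ℕ → Set c
  Polynomial m = List (Carrier × Exponent m)

  coefficient : ∀ {m} → Polynomial m → Exponent m → Carrier
  coefficient []            α = 0#
  coefficient ((a , β) ∷ p) α =
    (if does (≡-dec ℕ._≟_ β α) then a else 0#) + coefficient p α

  IsTotalDegree : ∀ {m} → Polynomial m → ℕ → Set ℓ
  IsTotalDegree p d = (∀ α → d ℕ.< ∣ α ∣ → coefficient p α ≈ 0#)
                    × (∃[ α ] (∣ α ∣ ≡ d × ¬ (coefficient p α ≈ 0#)))

  evaluate : ∀ {m} → Polynomial m → Vector Carrier m → Carrier
  evaluate p x = foldr
    (λ (a , α) s → a * product (λ i → x i ^ Vec.lookup α i) + s) 0# p

  -- The ring R[Z] for a symmetric n × n matrix Z of variables: one variable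
  -- for each pair i ≤ j.
  SymPolynomial : ℕ → Set c
  SymPolynomial n = Polynomial (triangle n)

  infix 9 _at_
  _at_ : ∀ {n} → SymPolynomial n → Matrix Carrier n → Carrier
  f at M = evaluate f (upperTriangle M)

  -- g = det(Z)^d · f(-Z⁻¹), as functions of the invertible symmetric matrix Z.
  -- Over an infinite field this determines the polynomial g.
  IsInversion : ∀ n → ℕ → SymPolynomial n → SymPolynomial n → Set (c ⊔ ℓ)
  IsInversion n d f g =
    (Z Z⁻¹ : Matrix Carrier n) → Symmetric Z → Inverse Z Z⁻¹ →
    g at Z ≈ det Z ^ d * f at (negate Z⁻¹)

module Complex {c ℓ₁ ℓ₂} (ℝ : Reals c ℓ₁ ℓ₂) where
  private module ℝ = Reals ℝ
  open ℝ using (_<_; _#_; 0#)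
  private module ℝ-Matrix = MatricesAndPolynomials ℝ.rawRing
  open RawSemiringDefinitions (RawRing.rawSemiring ℝ.rawRing) using (sum)

  -- A pair (x , y) stands for x + iy.
  ℂ : Set c
  ℂ = ℝ.Carrier × ℝ.Carrier

  ℂ-rawRing : RawRing c ℓ₁
  ℂ-rawRing = record
    { Carrier = ℂ
    ; _≈_ = λ (a , b) (x , y) → a ℝ.≈ x × b ℝ.≈ y
    ; _+_ = λ (a , b) (x , y) → a ℝ.+ x , b ℝ.+ y
    ; _*_ = λ (a , b) (x , y) → a ℝ.* x ℝ.- b ℝ.* y , a ℝ.* y ℝ.+ b ℝ.* x
    ; -_  = λ (a , b) → ℝ.- a , ℝ.- b
    ; 0#  = 0# , 0#
    ; 1#  = ℝ.1# , 0#
    }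

  open MatricesAndPolynomials ℂ-rawRing public

  Im : ∀ {n} → Matrix ℂ n → Matrix ℝ.Carrier n
  Im M i j = proj₂ (M i j)

  PositiveDefinite : ∀ {n} → Matrix ℝ.Carrier n → Set (c ⊔ ℓ₁ ⊔ ℓ₂)
  PositiveDefinite A = ℝ-Matrix.Symmetric A
    × ((x : Vector ℝ.Carrier _) → ∃[ i ] (x i # 0#) →
         0# < sum (λ i → sum (λ j → x i ℝ.* A i j ℝ.* x j)))

  PSDStable : ∀ n → SymPolynomial n → Set (c ⊔ ℓ₁ ⊔ ℓ₂)
  PSDStable n f = (M : Matrix ℂ n) → Symmetric M → PositiveDefinite (Im M) →
    ¬ (f at M ≈ 0ℂ)
    where open RawRing ℂ-rawRing using (_≈_) renaming (0# to 0ℂ)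

{-# OPTIONS --safe #-}

-- Existence: by Cramer's rule det(Z)·(-Z⁻¹) = -adj(Z), so each monomial of f of
-- degree at most d becomes a polynomial in Z when multiplied by det(Z)^d.
-- Determinants are handled as top coefficients of v_1 ∧ … ∧ v_n in an exterior
-- algebra, where v_1, …, v_n are the rows of the matrix.
--
-- Stability: let M be symmetric with Im M positive definite.  For every complex
-- vector w, Im (w* M w) = w* (Im M) w, which is positive unless w = 0.  Hence
-- det M ≠ 0, and substituting w = M⁻¹x for real x shows that Im (-M⁻¹) is
-- positive definite.  So f(-M⁻¹) ≠ 0 and det(M)^d · f(-M⁻¹) ≠ 0.

module Submission where

open import Defs
import Algebra.Apartness.Properties.HeytingCommutativeRing as HeytingProperties
open import Algebra.Apartness.Bundles using (HeytingCommutativeRing; HeytingField)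
open import Algebra.Bundles using (AbelianGroup; CommutativeRing)
open import Algebra.Bundles.Raw using (RawRing)
import Algebra.Consequences.Setoid as SetoidConsequences
import Algebra.Construct.DirectProduct as DirectProduct
import Algebra.Definitions as AlgebraDefinitions
import Algebra.Properties.CommutativeMonoid.Sum as CommutativeMonoidSum
import Algebra.Properties.CommutativeSemiring.Exp as Exp
import Algebra.Properties.Ring as RingProperties
import Algebra.Properties.Semiring.Sum as Summation
import Algebra.Solver.Ring.NaturalCoefficients.Default as SemiringSolver
open import Data.Bool.Base using (if_then_else_)
open import Data.Fin.Base using (Fin; zero; suc; toℕ; punchIn; punchOut; splitAt; _↑ˡ_; _↑ʳ_)
open import Data.Fin.Properties using (_≟_; punchIn-punchOut)
open import Data.Fin.Subset using (Subset; inside; outside; ⊤)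
open import Data.List.Base as List using ([]; _∷_; _++_; length)
open import Data.Nat.Base as ℕ using (ℕ; zero; suc; _≤_; _∸_; z≤n; s≤s)
import Data.Nat.Properties as ℕ
open import Data.Product.Base as Product using (_×_; _,_; ∃-syntax; proj₁; proj₂; uncurry)
open import Data.Sum.Base as Sum using (_⊎_; inj₁; inj₂)
open import Data.Vec.Base as Vec using ([]; _∷_; insertAt)
open import Data.Vec.Functional as Vector using (Vector; head; tail)
open import Data.Vec.Functional.Properties using (lookup-++ˡ; lookup-++ʳ)
open import Data.Vec.Properties using (≡-dec)
open import Function.Base using (_∘_)
open import Level using (_⊔_)
open import Relation.Binary.PropositionalEquality.Core as ≡ using (_≡_; _≢_)
import Relation.Binary.Reasoning.Setoid as ≈-Reasoning
open import Relation.Binary.Structures using (IsStrictPartialOrder)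
open import Relation.Nullary.Decidable.Core using (Dec; does; yes; no)
open import Relation.Nullary.Negation.Core using (¬_; contradiction)

-- The order on the reals is not assumed decidable, and this shapes the analytic half.
-- `PositiveDefinite` yields positivity only from an index whose entry is apart from 0, so each use
-- has to produce such an index; it is found inside a sum apart from 0 by cotransitivity.
-- Nonnegativity is expressed as the negation of being negative. Stability is itself a negation,
-- which is why det M ≠ 0 suffices: while g(M) = 0 is being refuted, det M may be taken apart from
-- 0, so that it has an inverse.
--
-- On the algebraic side `det` is given by first-row expansion only. In the exterior algebra, both
-- the vanishing for repeated rows and the signs of moved rows come down to how the wedge product
-- with vectors behaves. A polynomial is a list in which terms of degree above d may occur and
-- cancel, so the degree bound says nothing about a single term; comparing two sums over the list
-- requires grouping the terms by exponent.

-- Determinants through the exterior algebra.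

module Determinant {c ℓ} (R : CommutativeRing c ℓ) where
  open CommutativeRing R hiding (zero)
  open MatricesAndPolynomials rawRing
  open Summation semiring
  open Exp commutativeSemiring
  open RingProperties ring using (-1*x≈-x; -‿involutive)
  open SemiringSolver commutativeSemiring using (solve; _:=_; _:+_; _:*_)
  open ≈-Reasoning setoid

  -1*-1≈1 : - 1# * - 1# ≈ 1#
  -1*-1≈1 = trans (-1*x≈-x (- 1#)) (-‿involutive 1#)

  -1^k*-1^k≈1 : ∀ k → (- 1#) ^ k * (- 1#) ^ k ≈ 1#
  -1^k*-1^k≈1 zero    = *-identityˡ 1#
  -1^k*-1^k≈1 (suc k) = begin
    (- 1# * (- 1#) ^ k) * (- 1# * (- 1#) ^ k)
      ≈⟨ solve 2 (λ m p → (m :* p) :* (m :* p) := (m :* m) :* (p :* p)) refl (- 1#) ((- 1#) ^ k) ⟩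
    (- 1# * - 1#) * ((- 1#) ^ k * (- 1#) ^ k)
      ≈⟨ *-cong -1*-1≈1 (-1^k*-1^k≈1 k) ⟩
    1# * 1#
      ≈⟨ *-identityˡ 1# ⟩
    1# ∎

  -- ω s is the coefficient at the basis vector e_{s₁} ∧ … ∧ e_{sₖ}, where
  -- s₁ < … < sₖ are the elements of s.
  Multivector : ℕ → Set c
  Multivector n = Subset n → Carrier

  -- Left multiplication by v. With v = v₀ e₀ + v' and ω = ω₀ + e₀ ∧ ω₁, the product is v' ∧ ω₀ + e₀
  -- ∧ (v₀ ω₀ - v' ∧ ω₁); the sign comes from moving v' past e₀. In dimension zero v is 0.
  wedge : ∀ {n} → Vector Carrier n → Multivector n → Multivector n
  wedge v ω []            = 0#
  wedge v ω (outside ∷ s) = wedge (tail v) (ω ∘ (outside ∷_)) s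
  wedge v ω (inside ∷ s)  =
    head v * ω (outside ∷ s) + - 1# * wedge (tail v) (ω ∘ (inside ∷_)) s

  one : ∀ {n} → Multivector n
  one []            = 1#
  one (outside ∷ s) = one s
  one (inside ∷ s)  = 0#

  blade : ∀ {k n} → Vector (Vector Carrier n) k → Multivector n
  blade {zero}  V = one
  blade {suc k} V = wedge (head V) (blade (tail V))

  wedge-cong : ∀ {n} {v w : Vector Carrier n} {ω η : Multivector n} →
    (∀ i → v i ≈ w i) → (∀ s → ω s ≈ η s) → ∀ s → wedge v ω s ≈ wedge w η s
  wedge-cong v≈w ω≈η []            = refl
  wedge-cong v≈w ω≈η (outside ∷ s) =
    wedge-cong (v≈w ∘ suc) (ω≈η ∘ (outside ∷_)) s
  wedge-cong v≈w ω≈η (inside ∷ s)  = +-cong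
    (*-cong (v≈w zero) (ω≈η (outside ∷ s)))
    (*-congˡ (wedge-cong (v≈w ∘ suc) (ω≈η ∘ (inside ∷_)) s))

  blade-cong : ∀ {k n} {V W : Vector (Vector Carrier n) k} →
    (∀ i j → V i j ≈ W i j) → ∀ s → blade V s ≈ blade W s
  blade-cong {zero}  V≈W s = refl
  blade-cong {suc k} V≈W s =
    wedge-cong (V≈W zero) (blade-cong (V≈W ∘ suc)) s

  -- The two-term form is that of the `inside` clause of `wedge`, so nested wedges can be expanded
  -- with it.
  wedge-linear : ∀ {n} (v : Vector Carrier n) a b (ω η : Multivector n) s →
    wedge v (λ t → a * ω t + b * η t) s ≈ a * wedge v ω s + b * wedge v η s
  wedge-linear v a b ω η []            =
    sym (trans (+-cong (zeroʳ a) (zeroʳ b)) (+-identityˡ 0#))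
  wedge-linear v a b ω η (outside ∷ s) =
    wedge-linear (tail v) a b (ω ∘ (outside ∷_)) (η ∘ (outside ∷_)) s
  wedge-linear v a b ω η (inside ∷ s)  = trans
    (+-congˡ (*-congˡ (wedge-linear (tail v) a b (ω ∘ (inside ∷_)) (η ∘ (inside ∷_)) s)))
    (solve 8 (λ v₀ a b x y m p q →
        v₀ :* (a :* x :+ b :* y) :+ m :* (a :* p :+ b :* q)
        := a :* (v₀ :* x :+ m :* p) :+ b :* (v₀ :* y :+ m :* q))
      refl (head v) a b (ω (outside ∷ s)) (η (outside ∷ s)) (- 1#) _ _)

  wedge-scale : ∀ {n} (v : Vector Carrier n) a (ω : Multivector n) s →
    wedge v (λ t → a * ω t) s ≈ a * wedge v ω s
  wedge-scale v a ω s = begin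
    wedge v (λ t → a * ω t) s             ≈⟨ wedge-cong (λ _ → refl) (λ t → sym (drop (ω t))) s ⟩
    wedge v (λ t → a * ω t + 0# * ω t) s  ≈⟨ wedge-linear v a 0# ω ω s ⟩
    a * wedge v ω s + 0# * wedge v ω s    ≈⟨ drop (wedge v ω s) ⟩
    a * wedge v ω s                       ∎
    where
    drop : ∀ x → a * x + 0# * x ≈ a * x
    drop x = trans (+-congˡ (zeroˡ x)) (+-identityʳ (a * x))

  wedge-zero : ∀ {n} (v : Vector Carrier n) {ω : Multivector n} →
    (∀ s → ω s ≈ 0#) → ∀ s → wedge v ω s ≈ 0#
  wedge-zero v {ω} ω≈0 s = begin
    wedge v ω s                  ≈⟨ wedge-cong (λ _ → refl)
                                      (λ t → trans (ω≈0 t) (sym (zeroˡ (ω t)))) s ⟩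
    wedge v (λ t → 0# * ω t) s   ≈⟨ wedge-scale v 0# ω s ⟩
    0# * wedge v ω s             ≈⟨ zeroˡ _ ⟩
    0#                           ∎

  wedge-anticomm : ∀ {n} (v w : Vector Carrier n) (ω : Multivector n) s →
    wedge v (wedge w ω) s ≈ - 1# * wedge w (wedge v ω) s
  wedge-anticomm v w ω []            = sym (zeroʳ (- 1#))
  wedge-anticomm v w ω (outside ∷ s) =
    wedge-anticomm (tail v) (tail w) (ω ∘ (outside ∷_)) s
  wedge-anticomm v w ω (inside ∷ s)  = begin
    v₀ * W + m * wedge v′ (λ t → w₀ * ω₀ t + m * wedge w′ ω₁ t) s
      ≈⟨ +-congˡ (*-congˡ (wedge-linear v′ w₀ m ω₀ (wedge w′ ω₁) s)) ⟩
    v₀ * W + m * (w₀ * V + m * wedge v′ (wedge w′ ω₁) s)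
      ≈⟨ +-congˡ (*-congˡ (+-congˡ (*-congˡ (wedge-anticomm v′ w′ ω₁ s)))) ⟩
    v₀ * W + m * (w₀ * V + m * (m * X))
      -- The semiring solver treats `- 1#` as a variable m, so m * m = 1 is inserted by hand to make
      -- both sides agree as polynomials in m.
      ≈⟨ +-congʳ (sym (trans (*-congʳ -1*-1≈1) (*-identityˡ (v₀ * W)))) ⟩
    m * m * (v₀ * W) + m * (w₀ * V + m * (m * X))
      ≈⟨ solve 6 (λ m v₀ w₀ V W X →
           m :* m :* (v₀ :* W) :+ m :* (w₀ :* V :+ m :* (m :* X))
           := m :* (w₀ :* V :+ m :* (v₀ :* W :+ m :* X)))
         refl m v₀ w₀ V W X ⟩
    m * (w₀ * V + m * (v₀ * W + m * X))
      ≈⟨ *-congˡ (+-congˡ (*-congˡ (sym (wedge-linear w′ v₀ m ω₀ (wedge v′ ω₁) s)))) ⟩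
    m * (w₀ * V + m * wedge w′ (λ t → v₀ * ω₀ t + m * wedge v′ ω₁ t) s) ∎
    where
    m  = - 1#
    v₀ = head v
    w₀ = head w
    v′ = tail v
    w′ = tail w
    ω₀ = ω ∘ (outside ∷_)
    ω₁ = ω ∘ (inside ∷_)
    V  = wedge v′ ω₀ s
    W  = wedge w′ ω₀ s
    X  = wedge w′ (wedge v′ ω₁) s

  -- Anticommutativity gives only 2 (v ∧ v ∧ ω) = 0, and 2 need not be cancellable in R. Hence a
  -- separate induction, in which the two terms v₀ (v' ∧ ω₀) have opposite signs.
  wedge-square : ∀ {n} (v : Vector Carrier n) (ω : Multivector n) s →
    wedge v (wedge v ω) s ≈ 0#
  wedge-square v ω []            = refl
  wedge-square v ω (outside ∷ s) = wedge-square (tail v) (ω ∘ (outside ∷_)) s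
  wedge-square v ω (inside ∷ s)  = begin
    v₀ * V + m * wedge v′ (λ t → v₀ * ω₀ t + m * wedge v′ ω₁ t) s
      ≈⟨ +-congˡ (*-congˡ (wedge-linear v′ v₀ m ω₀ (wedge v′ ω₁) s)) ⟩
    v₀ * V + m * (v₀ * V + m * wedge v′ (wedge v′ ω₁) s)
      ≈⟨ +-congˡ (*-congˡ (+-congˡ (*-congˡ (wedge-square v′ ω₁ s)))) ⟩
    v₀ * V + m * (v₀ * V + m * 0#)
      ≈⟨ +-congˡ (*-congˡ (trans (+-congˡ (zeroʳ m)) (+-identityʳ _))) ⟩
    v₀ * V + m * (v₀ * V)
      ≈⟨ +-congˡ (-1*x≈-x _) ⟩
    v₀ * V + - (v₀ * V)
      ≈⟨ -‿inverseʳ _ ⟩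
    0# ∎
    where
    m  = - 1#
    v₀ = head v
    v′ = tail v
    ω₀ = ω ∘ (outside ∷_)
    ω₁ = ω ∘ (inside ∷_)
    V  = wedge v′ ω₀ s

  -- The repeated factor anticommutes past the earlier ones until it meets its copy, where
  -- `wedge-square` applies.
  wedge-blade-member : ∀ {k n} (V : Vector (Vector Carrier n) k) i s →
    wedge (V i) (blade V) s ≈ 0#
  wedge-blade-member {suc k} V zero    s = wedge-square (head V) (blade (tail V)) s
  wedge-blade-member {suc k} V (suc i) s = begin
    wedge (V (suc i)) (wedge (head V) (blade (tail V))) s
      ≈⟨ wedge-anticomm (V (suc i)) (head V) (blade (tail V)) s ⟩
    - 1# * wedge (head V) (wedge (V (suc i)) (blade (tail V))) s
      ≈⟨ *-congˡ (wedge-zero (head V) (wedge-blade-member (tail V) i) s) ⟩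
    - 1# * 0#
      ≈⟨ zeroʳ (- 1#) ⟩
    0# ∎

  -- Moving V i back to its place passes i factors, with one sign each.
  wedge-blade-removed : ∀ {k n} (V : Vector (Vector Carrier n) (suc k)) i s →
    wedge (V i) (blade (V ∘ punchIn i)) s ≈ (- 1#) ^ toℕ i * blade V s
  wedge-blade-removed         V zero    s = sym (*-identityˡ (blade V s))
  wedge-blade-removed {suc k} V (suc i) s = begin
    wedge (V (suc i)) (wedge (head V) (blade (tail V ∘ punchIn i))) s
      ≈⟨ wedge-anticomm (V (suc i)) (head V) _ s ⟩
    - 1# * wedge (head V) (wedge (V (suc i)) (blade (tail V ∘ punchIn i))) s
      ≈⟨ *-congˡ (wedge-cong (λ _ → refl) (wedge-blade-removed (tail V) i) s) ⟩
    - 1# * wedge (head V) (λ t → (- 1#) ^ toℕ i * blade (tail V) t) s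
      ≈⟨ *-congˡ (wedge-scale (head V) ((- 1#) ^ toℕ i) (blade (tail V)) s) ⟩
    - 1# * ((- 1#) ^ toℕ i * blade V s)
      ≈⟨ *-assoc (- 1#) _ _ ⟨
    - 1# * (- 1#) ^ toℕ i * blade V s ∎

  -- Reading coefficients at insertAt s j outside is the algebra map that
  -- sends e_j to 0.
  wedge-insertAt : ∀ {n} (v : Vector Carrier (suc n)) ω j s →
    wedge v ω (insertAt s j outside)
      ≈ wedge (v ∘ punchIn j) (λ t → ω (insertAt t j outside)) s
  wedge-insertAt v ω zero    s             = refl
  wedge-insertAt v ω (suc j) (outside ∷ s) =
    wedge-insertAt (tail v) (ω ∘ (outside ∷_)) j s
  wedge-insertAt v ω (suc j) (inside ∷ s)  =
    +-congˡ (*-congˡ (wedge-insertAt (tail v) (ω ∘ (inside ∷_)) j s))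

  one-insertAt : ∀ {n} j (s : Subset n) → one (insertAt s j outside) ≈ one s
  one-insertAt zero    s             = refl
  one-insertAt (suc j) (outside ∷ s) = one-insertAt j s
  one-insertAt (suc j) (inside ∷ s)  = refl

  blade-insertAt : ∀ {k n} (V : Vector (Vector Carrier (suc n)) k) j s →
    blade V (insertAt s j outside) ≈ blade (λ i → V i ∘ punchIn j) s
  blade-insertAt {zero}  V j s = one-insertAt j s
  blade-insertAt {suc k} V j s = trans
    (wedge-insertAt (head V) (blade (tail V)) j s)
    (wedge-cong (λ _ → refl) (blade-insertAt (tail V) j) s)

  -- Laplace expansion: the component of v along e_j meets the coefficient that omits e_j, and
  -- sorting e_j into place passes the j basis vectors before it.
  wedge-⊤ : ∀ {n} (v : Vector Carrier (suc n)) ω →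
    wedge v ω ⊤ ≈ ∑[ j < suc n ] ((- 1#) ^ toℕ j * (v j * ω (insertAt ⊤ j outside)))
  wedge-⊤ {zero}  v ω = begin
    v zero * ω (outside ∷ []) + - 1# * 0#  ≈⟨ +-cong (sym (*-identityˡ _)) (zeroʳ (- 1#)) ⟩
    1# * (v zero * ω (outside ∷ [])) + 0#  ∎
  wedge-⊤ {suc n} v ω = +-cong (sym (*-identityˡ _)) (begin
    - 1# * wedge (tail v) (ω ∘ (inside ∷_)) ⊤
      ≈⟨ *-congˡ (wedge-⊤ (tail v) (ω ∘ (inside ∷_))) ⟩
    - 1# * ∑[ j < suc n ] ((- 1#) ^ toℕ j * x j)
      ≈⟨ *-distribˡ-sum (- 1#) (λ j → (- 1#) ^ toℕ j * x j) ⟩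
    ∑[ j < suc n ] (- 1# * ((- 1#) ^ toℕ j * x j))
      ≈⟨ sum-cong-≋ (λ j → sym (*-assoc (- 1#) ((- 1#) ^ toℕ j) (x j))) ⟩
    ∑[ j < suc n ] ((- 1#) ^ suc (toℕ j) * x j) ∎)
    where
    x : Vector Carrier (suc n)
    x j = v (suc j) * ω (inside ∷ insertAt ⊤ j outside)

  -- Induction along the first-row expansion: deleting column j amounts to setting e_j to 0 in the
  -- blade of the remaining rows.
  det≈blade : ∀ {n} (M : Matrix Carrier n) → det M ≈ blade M ⊤
  det≈blade {zero}  M = refl
  det≈blade {suc n} M = trans
    (sum-cong-≋ (λ j → *-congˡ {(- 1#) ^ toℕ j} (*-congˡ {M zero j} (trans
      (det≈blade (λ i k → M (suc i) (punchIn j k)))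
      (sym (blade-insertAt (tail M) j ⊤))))))
    (sym (wedge-⊤ (head M) (blade (tail M))))

  -- Adjugates and inverses.

  -- The entry at (i, k) is the cofactor at (k, i). Its sign is kept as two factors: the power for i
  -- belongs to the Laplace expansion, the power for k is the cost of moving row k to the front. For
  -- n = 0 there are no entries.
  adjugate : ∀ {n} → Matrix Carrier n → Matrix Carrier n
  adjugate {suc n} M i k =
    (- 1#) ^ toℕ k * ((- 1#) ^ toℕ i * det (λ a b → M (punchIn k a) (punchIn i b)))

  identity-diagonal : ∀ {n} (i : Fin n) → identity i i ≡ 1#
  identity-diagonal zero    = ≡.refl
  identity-diagonal (suc i) = identity-diagonal i

  identity-off-diagonal : ∀ {n} {i j : Fin n} → i ≢ j → identity i j ≡ 0#
  identity-off-diagonal {i = zero}  {zero}  i≢j = contradiction ≡.refl i≢j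
  identity-off-diagonal {i = zero}  {suc j} i≢j = ≡.refl
  identity-off-diagonal {i = suc i} {zero}  i≢j = ≡.refl
  identity-off-diagonal {i = suc i} {suc j} i≢j = identity-off-diagonal (i≢j ∘ ≡.cong suc)

  -- By Laplace expansion, the left side is the top coefficient of
  -- ± v_j ∧ (v_0 ∧ … v̂_k … ∧ v_n), where v_0, …, v_n are the rows of M.
  ⊗-adjugate : ∀ {n} (M : Matrix Carrier n) j k →
    (M ⊗ adjugate M) j k ≈ det M * identity j k
  ⊗-adjugate {suc n} M j k = begin
    ∑[ i < suc n ] (M j i * (σ k * (σ i * minor i)))
      ≈⟨ sum-cong-≋ (λ i → solve 4 (λ x s t y → x :* (s :* (t :* y)) := s :* (t :* (x :* y)))
           refl (M j i) (σ k) (σ i) (minor i)) ⟩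
    ∑[ i < suc n ] (σ k * (σ i * (M j i * minor i)))
      ≈⟨ *-distribˡ-sum (σ k) (λ i → σ i * (M j i * minor i)) ⟨
    σ k * ∑[ i < suc n ] (σ i * (M j i * minor i))
      ≈⟨ *-congˡ (det≈blade (M j Vector.∷ (M ∘ punchIn k))) ⟩
    σ k * wedge (M j) (blade (M ∘ punchIn k)) ⊤
      ≈⟨ repeated (j ≟ k) ⟩
    det M * identity j k ∎
    where
    σ : Fin (suc n) → Carrier
    σ i = (- 1#) ^ toℕ i
    minor : Fin (suc n) → Carrier
    minor i = det (λ a b → M (punchIn k a) (punchIn i b))
    repeated : _ → σ k * wedge (M j) (blade (M ∘ punchIn k)) ⊤ ≈ det M * identity j k
    repeated (yes ≡.refl) = begin
      σ k * wedge (M k) (blade (M ∘ punchIn k)) ⊤  ≈⟨ *-congˡ (wedge-blade-removed M k ⊤) ⟩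
      σ k * (σ k * blade M ⊤)                      ≈⟨ *-assoc (σ k) (σ k) _ ⟨
      σ k * σ k * blade M ⊤                        ≈⟨ *-congʳ (-1^k*-1^k≈1 (toℕ k)) ⟩
      1# * blade M ⊤                               ≈⟨ *-comm 1# _ ⟩
      blade M ⊤ * 1#                               ≈⟨ *-cong (sym (det≈blade M))
                                                              (reflexive (≡.sym (identity-diagonal k))) ⟩
      det M * identity k k                         ∎
    repeated (no j≢k) = begin
      σ k * wedge (M j) (blade (M ∘ punchIn k)) ⊤
        ≈⟨ *-congˡ (reflexive (≡.cong (λ i → wedge (M i) (blade (M ∘ punchIn k)) ⊤)
                                        (punchIn-punchOut k≢j))) ⟨
      σ k * wedge (M (punchIn k (punchOut k≢j))) (blade (M ∘ punchIn k)) ⊤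
        ≈⟨ *-congˡ (wedge-blade-member (M ∘ punchIn k) (punchOut k≢j) ⊤) ⟩
      σ k * 0#
        ≈⟨ zeroʳ (σ k) ⟩
      0#
        ≈⟨ zeroʳ (det M) ⟨
      det M * 0#
        ≈⟨ *-congˡ (reflexive (≡.sym (identity-off-diagonal j≢k))) ⟩
      det M * identity j k ∎
      where
      k≢j = j≢k ∘ ≡.sym

  sum-identityˡ : ∀ {n} (i : Fin n) (x : Vector Carrier n) → sum (λ j → identity i j * x j) ≈ x i
  sum-identityˡ {suc n} zero    x = begin
    1# * x zero + sum (λ j → 0# * x (suc j))  ≈⟨ +-cong (*-identityˡ _) (sym (*-distribˡ-sum 0# (tail x))) ⟩
    x zero + 0# * sum (tail x)                ≈⟨ +-congˡ (zeroˡ _) ⟩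
    x zero + 0#                               ≈⟨ +-identityʳ _ ⟩
    x zero                                    ∎
  sum-identityˡ {suc n} (suc i) x = begin
    0# * x zero + sum (λ j → identity i j * x (suc j))  ≈⟨ +-cong (zeroˡ _) (sum-identityˡ i (tail x)) ⟩
    0# + x (suc i)                                      ≈⟨ +-identityˡ _ ⟩
    x (suc i)                                           ∎

  identity-symmetric : ∀ {n} → Symmetric (identity {n})
  identity-symmetric zero    zero    = refl
  identity-symmetric zero    (suc j) = refl
  identity-symmetric (suc i) zero    = refl
  identity-symmetric (suc i) (suc j) = identity-symmetric i j

  ⊗-transpose : ∀ {n} (M N : Matrix Carrier n) i j →
    (M ⊗ N) i j ≈ (Vector.transpose N ⊗ Vector.transpose M) j i
  ⊗-transpose M N i j = sum-cong-≋ (λ k → *-comm (M i k) (N k j))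

  ⊗-cong : ∀ {n} {M M′ N N′ : Matrix Carrier n} →
    (∀ i j → M i j ≈ M′ i j) → (∀ i j → N i j ≈ N′ i j) →
    ∀ i j → (M ⊗ N) i j ≈ (M′ ⊗ N′) i j
  ⊗-cong M≈M′ N≈N′ i j = sum-cong-≋ (λ k → *-cong (M≈M′ i k) (N≈N′ k j))

  ⊗-identityˡ : ∀ {n} (M : Matrix Carrier n) i j → (identity ⊗ M) i j ≈ M i j
  ⊗-identityˡ M i j = sum-identityˡ i (λ k → M k j)

  ⊗-identityʳ : ∀ {n} (M : Matrix Carrier n) i j → (M ⊗ identity) i j ≈ M i j
  ⊗-identityʳ M i j = trans
    (sum-cong-≋ (λ k → trans (*-comm (M i k) (identity k j)) (*-congʳ (identity-symmetric k j))))
    (sum-identityˡ j (M i))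

  -- Stated for a vector because it serves twice: with a column for x it is associativity of `⊗`,
  -- and with N inverse to M it gives M (N x) = x.
  ⊗-apply-assoc : ∀ {n} (M N : Matrix Carrier n) (x : Vector Carrier n) i →
    sum (λ k → (M ⊗ N) i k * x k) ≈ sum (λ j → M i j * sum (λ k → N j k * x k))
  ⊗-apply-assoc {n} M N x i = begin
    ∑[ k < n ] (∑[ j < n ] (M i j * N j k) * x k)
      ≈⟨ sum-cong-≋ (λ k → *-distribʳ-sum (x k) (λ j → M i j * N j k)) ⟩
    ∑[ k < n ] ∑[ j < n ] (M i j * N j k * x k)
      ≈⟨ ∑-comm (λ k j → M i j * N j k * x k) ⟩
    ∑[ j < n ] ∑[ k < n ] (M i j * N j k * x k)
      ≈⟨ sum-cong-≋ (λ j → trans (sum-cong-≋ (λ k → *-assoc (M i j) (N j k) (x k)))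
                                 (sym (*-distribˡ-sum (M i j) (λ k → N j k * x k)))) ⟩
    ∑[ j < n ] (M i j * ∑[ k < n ] (N j k * x k)) ∎

  ⊗-assoc : ∀ {n} (L M N : Matrix Carrier n) i j →
    ((L ⊗ M) ⊗ N) i j ≈ (L ⊗ (M ⊗ N)) i j
  ⊗-assoc L M N i j = ⊗-apply-assoc L M (λ k → N k j) i

  -- Multiply M adj(M) = det(M) I by N on the left; nothing is divided by det(M).
  adjugate≈det*inverse : ∀ {n} (M N : Matrix Carrier n) → Inverse M N →
    ∀ i j → adjugate M i j ≈ det M * N i j
  adjugate≈det*inverse {n} M N (_ , NM≈1) i j = begin
    adjugate M i j                           ≈⟨ ⊗-identityˡ (adjugate M) i j ⟨
    (identity ⊗ adjugate M) i j              ≈⟨ ⊗-cong {N = adjugate M} NM≈1 (λ _ _ → refl) i j ⟨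
    ((N ⊗ M) ⊗ adjugate M) i j               ≈⟨ ⊗-assoc N M (adjugate M) i j ⟩
    (N ⊗ (M ⊗ adjugate M)) i j               ≈⟨ ⊗-cong {M = N} (λ _ _ → refl) (⊗-adjugate M) i j ⟩
    (N ⊗ (λ k l → det M * identity k l)) i j ≈⟨ sum-cong-≋ (λ k →
      solve 3 (λ x d y → x :* (d :* y) := d :* (x :* y)) refl (N i k) (det M) (identity k j)) ⟩
    ∑[ k < n ] (det M * (N i k * identity k j)) ≈⟨ *-distribˡ-sum (det M) (λ k → N i k * identity k j) ⟨
    det M * (N ⊗ identity) i j               ≈⟨ *-congˡ (⊗-identityʳ N i j) ⟩
    det M * N i j                            ∎

  -- Transposing M N = I gives Nᵀ M = I because M is symmetric, and then Nᵀ = Nᵀ (M N) = N.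
  rightInverse-symmetric : ∀ {n} (M N : Matrix Carrier n) → Symmetric M →
    (∀ i j → (M ⊗ N) i j ≈ identity i j) → Symmetric N
  rightInverse-symmetric M N M-sym MN≈1 i j = sym (begin
    N j i                    ≈⟨ ⊗-identityʳ Nᵀ i j ⟨
    (Nᵀ ⊗ identity) i j      ≈⟨ ⊗-cong {M = Nᵀ} (λ _ _ → refl) MN≈1 i j ⟨
    (Nᵀ ⊗ (M ⊗ N)) i j       ≈⟨ ⊗-assoc Nᵀ M N i j ⟨
    ((Nᵀ ⊗ M) ⊗ N) i j       ≈⟨ ⊗-cong {N = N} NᵀM≈1 (λ _ _ → refl) i j ⟩
    (identity ⊗ N) i j       ≈⟨ ⊗-identityˡ N i j ⟩
    N i j                    ∎)
    where
    Nᵀ = Vector.transpose N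
    NᵀM≈1 : ∀ k l → (Nᵀ ⊗ M) k l ≈ identity k l
    NᵀM≈1 k l = begin
      (Nᵀ ⊗ M) k l                     ≈⟨ ⊗-cong {M = Nᵀ} (λ _ _ → refl) M-sym k l ⟩
      (Nᵀ ⊗ Vector.transpose M) k l    ≈⟨ ⊗-transpose M N l k ⟨
      (M ⊗ N) l k                      ≈⟨ MN≈1 l k ⟩
      identity l k                     ≈⟨ identity-symmetric l k ⟩
      identity k l                     ∎

  -- M and N are both symmetric, so N M is the transpose of M N.
  symmetric-rightInverse : ∀ {n} (M N : Matrix Carrier n) → Symmetric M →
    (∀ i j → (M ⊗ N) i j ≈ identity i j) → Inverse M N
  symmetric-rightInverse M N M-sym MN≈1 = MN≈1 , λ i j → begin
    (N ⊗ M) i j                                     ≈⟨ ⊗-cong (rightInverse-symmetric M N M-sym MN≈1) M-sym i j ⟩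
    (Vector.transpose N ⊗ Vector.transpose M) i j   ≈⟨ ⊗-transpose M N j i ⟨
    (M ⊗ N) j i                                     ≈⟨ MN≈1 j i ⟩
    identity j i                                    ≈⟨ identity-symmetric j i ⟩
    identity i j                                    ∎

-- Coordinates on symmetric matrices.

module _ {a b} {A : Set a} {B : Set b} (h : A → B) where

  upperTriangle-natural : ∀ {n} (M : Matrix A n) t →
    upperTriangle (λ i j → h (M i j)) t ≡ h (upperTriangle M t)
  upperTriangle-natural {suc n} M t with splitAt (suc n) t
  ... | inj₁ j = ≡.refl
  ... | inj₂ s = upperTriangle-natural (λ i j → M (suc i) (suc j)) s

-- The matrix whose entry at (i, j) is the pair (i, j) itself, read in coordinates: it locates each
-- variable in the matrix.
position : ∀ {n} → Fin (triangle n) → Fin n × Fin n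
position = upperTriangle _,_

upperTriangle-position : ∀ {a} {A : Set a} {n} (M : Matrix A n) t →
  upperTriangle M t ≡ uncurry M (position t)
upperTriangle-position M = upperTriangle-natural (uncurry M) _,_

-- Polynomials as formal sums and as functions.

module PolynomialFunctions {c ℓ} (R : CommutativeRing c ℓ) where
  open CommutativeRing R hiding (zero)
  open MatricesAndPolynomials rawRing
  open Determinant R
  open Summation semiring
  open Exp commutativeSemiring
  open RingProperties ring using (-‿distribʳ-*; -1*x≈-x)
  private module Prod = CommutativeMonoidSum *-commutativeMonoid
  open Prod using () renaming (sum to product)
  open SemiringSolver commutativeSemiring using (solve; _:=_; _:+_; _:*_; con)
  open ≈-Reasoning setoid

  monomial : ∀ {m} → Exponent m → Vector Carrier m → Carrier
  monomial α x = product (λ i → x i ^ Vec.lookup α i)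

  -- The linear functional sending x^α to φ α. Evaluation at a point is one instance and the
  -- inverted polynomial another, so the two can be compared through φ alone.
  weightedSum : ∀ {m} → (Exponent m → Carrier) → Polynomial m → Carrier
  weightedSum φ []            = 0#
  weightedSum φ ((a , α) ∷ p) = a * φ α + weightedSum φ p

  remove : ∀ {m} → Exponent m → Polynomial m → Polynomial m
  remove α []            = []
  remove α ((b , β) ∷ p) =
    if does (≡-dec ℕ._≟_ β α) then remove α p else (b , β) ∷ remove α p

  weightedSum-remove : ∀ {m} (φ : Exponent m → Carrier) α p →
    weightedSum φ p ≈ coefficient p α * φ α + weightedSum φ (remove α p)
  weightedSum-remove φ α []            = sym (trans (+-identityʳ _) (zeroˡ _))
  weightedSum-remove φ α ((b , β) ∷ p) with ≡-dec ℕ._≟_ β α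
  ... | yes ≡.refl = trans (+-congˡ (weightedSum-remove φ β p))
    (solve 4 (λ x y z w → x :* z :+ (y :* z :+ w) := (x :+ y) :* z :+ w) refl
      b (coefficient p β) (φ β) (weightedSum φ (remove β p)))
  ... | no _ = trans (+-congˡ (weightedSum-remove φ α p))
    (solve 5 (λ x y z w v → x :* v :+ (y :* z :+ w) := (con 0 :+ y) :* z :+ (x :* v :+ w)) refl
      b (coefficient p α) (φ α) (weightedSum φ (remove α p)) (φ β))

  coefficient-remove-≡ : ∀ {m} (α : Exponent m) p → coefficient (remove α p) α ≈ 0#
  coefficient-remove-≡ α []            = refl
  coefficient-remove-≡ α ((b , β) ∷ p) with ≡-dec ℕ._≟_ β α in eq
  ... | yes _ = coefficient-remove-≡ α p
  -- `coefficient` tests the kept head again, so the outcome of the test has to be rewritten a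
  -- second time.
  ... | no  _ rewrite eq = trans (+-identityˡ _) (coefficient-remove-≡ α p)

  coefficient-remove-≢ : ∀ {m} {α γ : Exponent m} → γ ≢ α → ∀ p →
    coefficient (remove α p) γ ≈ coefficient p γ
  coefficient-remove-≢ γ≢α []            = refl
  coefficient-remove-≢ {α = α} {γ} γ≢α ((b , β) ∷ p) with ≡-dec ℕ._≟_ β α
  ... | no _ = +-congˡ (coefficient-remove-≢ γ≢α p)
  ... | yes ≡.refl with ≡-dec ℕ._≟_ β γ
  ...   | yes β≡γ = contradiction (≡.sym β≡γ) γ≢α
  ...   | no _    = trans (coefficient-remove-≢ γ≢α p) (sym (+-identityˡ _))

  length-remove : ∀ {m} (α : Exponent m) p → length (remove α p) ≤ length p
  length-remove α []            = z≤n
  length-remove α ((b , β) ∷ p) with ≡-dec ℕ._≟_ β α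
  ... | yes _ = ℕ.m≤n⇒m≤1+n (length-remove α p)
  ... | no _  = s≤s (length-remove α p)

  length-remove-head : ∀ {m} b (β : Exponent m) p →
    length (remove β ((b , β) ∷ p)) ≤ length p
  length-remove-head b β p with ≡-dec ℕ._≟_ β β
  ... | yes _  = length-remove β p
  ... | no β≢β = contradiction ≡.refl β≢β

  -- φ and ψ may differ wherever the total coefficient vanishes, even if single terms with that
  -- exponent occur in p. All terms sharing the exponent of the head are therefore collected and
  -- exchanged at once.
  weightedSum-cong : ∀ {m} {φ ψ : Exponent m → Carrier} p →
    (∀ α → coefficient p α * φ α ≈ coefficient p α * ψ α) →
    weightedSum φ p ≈ weightedSum ψ p
  weightedSum-cong {m} {φ} {ψ} p = bounded (length p) p ℕ.≤-refl
    where
    -- The list left after `remove` is not a structural part of p, so the recursion is on a bound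
    -- for its length.
    bounded : ∀ k p → length p ≤ k →
      (∀ α → coefficient p α * φ α ≈ coefficient p α * ψ α) →
      weightedSum φ p ≈ weightedSum ψ p
    bounded k       []            _       agree = refl
    bounded (suc k) (t@(b , β) ∷ p) (s≤s p≤k) agree = begin
      weightedSum φ (t ∷ p)
        ≈⟨ weightedSum-remove φ β (t ∷ p) ⟩
      coefficient (t ∷ p) β * φ β + weightedSum φ (remove β (t ∷ p))
        ≈⟨ +-cong (agree β) (bounded k (remove β (t ∷ p))
             (ℕ.≤-trans (length-remove-head b β p) p≤k) agree′) ⟩
      coefficient (t ∷ p) β * ψ β + weightedSum ψ (remove β (t ∷ p))
        ≈⟨ weightedSum-remove ψ β (t ∷ p) ⟨
      weightedSum ψ (t ∷ p) ∎
      where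
      agree′ : ∀ α → coefficient (remove β (t ∷ p)) α * φ α
                   ≈ coefficient (remove β (t ∷ p)) α * ψ α
      agree′ α with ≡-dec ℕ._≟_ α β
      ... | yes ≡.refl = trans (vanish (φ β)) (sym (vanish (ψ β)))
        where
        vanish : ∀ x → coefficient (remove β (t ∷ p)) β * x ≈ 0#
        vanish x = trans (*-congʳ (coefficient-remove-≡ β (t ∷ p))) (zeroˡ x)
      ... | no α≢β = begin
        coefficient (remove β (t ∷ p)) α * φ α  ≈⟨ *-congʳ (coefficient-remove-≢ α≢β (t ∷ p)) ⟩
        coefficient (t ∷ p) α * φ α             ≈⟨ agree α ⟩
        coefficient (t ∷ p) α * ψ α             ≈⟨ *-congʳ (coefficient-remove-≢ α≢β (t ∷ p)) ⟨
        coefficient (remove β (t ∷ p)) α * ψ α  ∎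

  weightedSum-distribˡ : ∀ {m} x (φ : Exponent m → Carrier) p →
    x * weightedSum φ p ≈ weightedSum (λ α → x * φ α) p
  weightedSum-distribˡ x φ []            = zeroʳ x
  weightedSum-distribˡ x φ ((a , α) ∷ p) = begin
    x * (a * φ α + weightedSum φ p)
      ≈⟨ solve 4 (λ x a y s → x :* (a :* y :+ s) := a :* (x :* y) :+ x :* s) refl
           x a (φ α) (weightedSum φ p) ⟩
    a * (x * φ α) + x * weightedSum φ p
      ≈⟨ +-congˡ (weightedSum-distribˡ x φ p) ⟩
    a * (x * φ α) + weightedSum (λ α → x * φ α) p ∎

  evaluate≈weightedSum : ∀ {m} (p : Polynomial m) x →
    evaluate p x ≈ weightedSum (λ α → monomial α x) p
  evaluate≈weightedSum []      x = refl
  evaluate≈weightedSum (t ∷ p) x = +-congˡ (evaluate≈weightedSum p x)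

  monomial-+ : ∀ {m} (α β : Exponent m) x →
    monomial (Vec.zipWith ℕ._+_ α β) x ≈ monomial α x * monomial β x
  monomial-+ []      []      x = sym (*-identityˡ 1#)
  monomial-+ (a ∷ α) (b ∷ β) x = begin
    head x ^ (a ℕ.+ b) * monomial (Vec.zipWith ℕ._+_ α β) (tail x)
      ≈⟨ *-cong (^-homo-* (head x) a b) (monomial-+ α β (tail x)) ⟩
    (head x ^ a * head x ^ b) * (monomial α (tail x) * monomial β (tail x))
      ≈⟨ solve 4 (λ p q r s → (p :* q) :* (r :* s) := (p :* r) :* (q :* s)) refl _ _ _ _ ⟩
    (head x ^ a * monomial α (tail x)) * (head x ^ b * monomial β (tail x)) ∎

  monomial-0 : ∀ {m} (x : Vector Carrier m) → monomial (Vec.replicate m 0) x ≈ 1#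
  monomial-0 {zero}  x = refl
  monomial-0 {suc m} x = trans (*-identityˡ _) (monomial-0 (tail x))

  monomial-variable : ∀ {m} t (x : Vector Carrier m) →
    monomial (Vec.replicate m 0 Vec.[ t ]≔ 1) x ≈ x t
  monomial-variable zero    x = trans
    (*-cong (*-identityʳ (head x)) (monomial-0 (tail x))) (*-identityʳ (head x))
  monomial-variable (suc t) x = trans (*-identityˡ _) (monomial-variable t (tail x))

  monomial-scale : ∀ {m} y (α : Exponent m) x →
    y ^ ∣ α ∣ * monomial α x ≈ monomial α (λ t → y * x t)
  monomial-scale y []      x = *-identityˡ 1#
  monomial-scale y (a ∷ α) x = begin
    y ^ (a ℕ.+ ∣ α ∣) * (head x ^ a * monomial α (tail x))
      ≈⟨ *-congʳ (^-homo-* y a ∣ α ∣) ⟩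
    (y ^ a * y ^ ∣ α ∣) * (head x ^ a * monomial α (tail x))
      ≈⟨ solve 4 (λ p q r s → (p :* q) :* (r :* s) := (p :* r) :* (q :* s)) refl _ _ _ _ ⟩
    (y ^ a * head x ^ a) * (y ^ ∣ α ∣ * monomial α (tail x))
      ≈⟨ *-cong (sym (^-distrib-* y (head x) a)) (monomial-scale y α (tail x)) ⟩
    (y * head x) ^ a * monomial α (λ t → y * tail x t) ∎

  monomial-cong : ∀ {m} (α : Exponent m) {x y : Vector Carrier m} →
    (∀ t → x t ≈ y t) → monomial α x ≈ monomial α y
  monomial-cong α x≈y = Prod.sum-cong-≋ (λ t → ^-congˡ (Vec.lookup α t) (x≈y t))

  evaluate-++ : ∀ {m} (p q : Polynomial m) x →
    evaluate (p ++ q) x ≈ evaluate p x + evaluate q x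
  evaluate-++ []      q x = sym (+-identityˡ _)
  evaluate-++ (t ∷ p) q x = trans (+-congˡ (evaluate-++ p q x)) (sym (+-assoc _ _ _))

  multiplyTerm : ∀ {m} → Carrier × Exponent m → Polynomial m → Polynomial m
  multiplyTerm (a , α) = List.map (λ (b , β) → a * b , Vec.zipWith ℕ._+_ α β)

  multiply : ∀ {m} → Polynomial m → Polynomial m → Polynomial m
  multiply []      q = []
  multiply (t ∷ p) q = multiplyTerm t q ++ multiply p q

  evaluate-multiplyTerm : ∀ {m} a (α : Exponent m) q x →
    evaluate (multiplyTerm (a , α) q) x ≈ a * monomial α x * evaluate q x
  evaluate-multiplyTerm a α []            x = sym (zeroʳ _)
  evaluate-multiplyTerm a α ((b , β) ∷ q) x = begin
    a * b * monomial (Vec.zipWith ℕ._+_ α β) x + evaluate (multiplyTerm (a , α) q) x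
      ≈⟨ +-cong (*-congˡ (monomial-+ α β x)) (evaluate-multiplyTerm a α q x) ⟩
    a * b * (monomial α x * monomial β x) + a * monomial α x * evaluate q x
      ≈⟨ solve 5 (λ a b p q r → a :* b :* (p :* q) :+ a :* p :* r := a :* p :* (b :* q :+ r)) refl
           a b (monomial α x) (monomial β x) (evaluate q x) ⟩
    a * monomial α x * (b * monomial β x + evaluate q x) ∎

  evaluate-multiply : ∀ {m} (p q : Polynomial m) x →
    evaluate (multiply p q) x ≈ evaluate p x * evaluate q x
  evaluate-multiply []            q x = sym (zeroˡ _)
  evaluate-multiply ((a , α) ∷ p) q x = begin
    evaluate (multiplyTerm (a , α) q ++ multiply p q) x
      ≈⟨ evaluate-++ (multiplyTerm (a , α) q) (multiply p q) x ⟩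
    evaluate (multiplyTerm (a , α) q) x + evaluate (multiply p q) x
      ≈⟨ +-cong (evaluate-multiplyTerm a α q x) (evaluate-multiply p q x) ⟩
    a * monomial α x * evaluate q x + evaluate p x * evaluate q x
      ≈⟨ distribʳ _ _ _ ⟨
    (a * monomial α x + evaluate p x) * evaluate q x ∎

  -- Polynomial functions of a symmetric matrix.

  -- Agreement is asked only at symmetric Z, since the coordinates see only the upper triangle.
  IsPolynomial : ∀ {n} → (Matrix Carrier n → Carrier) → Set (c ⊔ ℓ)
  IsPolynomial F = ∃[ g ] (∀ Z → Symmetric Z → g at Z ≈ F Z)

  module _ {n : ℕ} where

    private variable
      k : ℕ
      F G : Matrix Carrier n → Carrier

    constant-isPolynomial : ∀ a → IsPolynomial {n} (λ _ → a)
    constant-isPolynomial a = (a , Vec.replicate _ 0) ∷ [] , λ Z _ → begin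
      a * monomial (Vec.replicate _ 0) (upperTriangle Z) + 0#  ≈⟨ +-identityʳ _ ⟩
      a * monomial (Vec.replicate _ 0) (upperTriangle Z)       ≈⟨ *-congˡ (monomial-0 (upperTriangle Z)) ⟩
      a * 1#                                                   ≈⟨ *-identityʳ a ⟩
      a                                                        ∎

    +-isPolynomial : IsPolynomial F → IsPolynomial G → IsPolynomial (λ Z → F Z + G Z)
    +-isPolynomial (p , p≈F) (q , q≈G) = p ++ q , λ Z sym-Z →
      trans (evaluate-++ p q (upperTriangle Z)) (+-cong (p≈F Z sym-Z) (q≈G Z sym-Z))

    *-isPolynomial : IsPolynomial F → IsPolynomial G → IsPolynomial (λ Z → F Z * G Z)
    *-isPolynomial (p , p≈F) (q , q≈G) = multiply p q , λ Z sym-Z →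
      trans (evaluate-multiply p q (upperTriangle Z)) (*-cong (p≈F Z sym-Z) (q≈G Z sym-Z))

    neg-isPolynomial : IsPolynomial F → IsPolynomial (λ Z → - F Z)
    neg-isPolynomial F-poly with *-isPolynomial (constant-isPolynomial (- 1#)) F-poly
    ... | p , p≈-1*F = p , λ Z sym-Z → trans (p≈-1*F Z sym-Z) (-1*x≈-x _)

    ^-isPolynomial : ∀ e → IsPolynomial F → IsPolynomial (λ Z → F Z ^ e)
    ^-isPolynomial zero    F-poly = constant-isPolynomial 1#
    ^-isPolynomial (suc e) F-poly = *-isPolynomial F-poly (^-isPolynomial e F-poly)

    sum-isPolynomial : {H : Fin k → Matrix Carrier n → Carrier} →
      (∀ i → IsPolynomial (H i)) → IsPolynomial (λ Z → sum (λ i → H i Z))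
    sum-isPolynomial {k = zero}  H-poly = constant-isPolynomial 0#
    sum-isPolynomial {k = suc k} H-poly =
      +-isPolynomial (H-poly zero) (sum-isPolynomial (H-poly ∘ suc))

    product-isPolynomial : {H : Fin k → Matrix Carrier n → Carrier} →
      (∀ i → IsPolynomial (H i)) → IsPolynomial (λ Z → product (λ i → H i Z))
    product-isPolynomial {k = zero}  H-poly = constant-isPolynomial 1#
    product-isPolynomial {k = suc k} H-poly =
      *-isPolynomial (H-poly zero) (product-isPolynomial (H-poly ∘ suc))

    weightedSum-isPolynomial : {φ : Matrix Carrier n → Exponent k → Carrier} →
      (∀ α → IsPolynomial (λ Z → φ Z α)) → ∀ p → IsPolynomial (λ Z → weightedSum (φ Z) p)
    weightedSum-isPolynomial φ-poly []            = constant-isPolynomial 0#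
    weightedSum-isPolynomial φ-poly ((a , α) ∷ p) = +-isPolynomial
      (*-isPolynomial (constant-isPolynomial a) (φ-poly α))
      (weightedSum-isPolynomial φ-poly p)

    -- A matrix of polynomial functions takes the place of Z because the induction passes to minors,
    -- which need not be symmetric.
    det-isPolynomial : {H : Matrix Carrier n → Matrix Carrier k} →
      (∀ i j → IsPolynomial (λ Z → H Z i j)) → IsPolynomial (λ Z → det (H Z))
    det-isPolynomial {k = zero}  H-poly = constant-isPolynomial 1#
    det-isPolynomial {k = suc k} H-poly = sum-isPolynomial (λ j →
      *-isPolynomial (constant-isPolynomial ((- 1#) ^ toℕ j))
        (*-isPolynomial (H-poly zero j)
          (det-isPolynomial (λ a b → H-poly (suc a) (punchIn j b)))))

    adjugate-isPolynomial : {H : Matrix Carrier n → Matrix Carrier k} →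
      (∀ i j → IsPolynomial (λ Z → H Z i j)) →
      ∀ i j → IsPolynomial (λ Z → adjugate (H Z) i j)
    adjugate-isPolynomial {k = suc k} H-poly i j =
      *-isPolynomial (constant-isPolynomial ((- 1#) ^ toℕ j))
        (*-isPolynomial (constant-isPolynomial ((- 1#) ^ toℕ i))
          (det-isPolynomial (λ a b → H-poly (punchIn j a) (punchIn i b))))

    upperTriangle-isPolynomial : ∀ t → IsPolynomial {n} (λ Z → upperTriangle Z t)
    upperTriangle-isPolynomial t =
      (1# , Vec.replicate _ 0 Vec.[ t ]≔ 1) ∷ [] , λ Z _ →
        trans (+-identityʳ _) (trans (*-identityˡ _) (monomial-variable t (upperTriangle Z)))

  symmetric-coordinate : ∀ {n} (i j : Fin n) →
    ∃[ t ] (∀ Z → Symmetric Z → upperTriangle Z t ≈ Z i j)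
  symmetric-coordinate {suc n} zero j = j ↑ˡ triangle n , λ Z _ →
    reflexive (lookup-++ˡ (head Z) _ j)
  -- An entry below the diagonal is stored as its mirror image in the first row.
  symmetric-coordinate {suc n} (suc i) zero = suc i ↑ˡ triangle n , λ Z sym-Z →
    trans (reflexive (lookup-++ˡ (head Z) _ (suc i))) (sym-Z zero (suc i))
  symmetric-coordinate {suc n} (suc i) (suc j) with symmetric-coordinate i j
  ... | t , t-coordinate = suc n ↑ʳ t , λ Z sym-Z → trans
    (reflexive (lookup-++ʳ (head Z) _ t))
    (t-coordinate (λ i j → Z (suc i) (suc j)) (λ i j → sym-Z (suc i) (suc j)))

  entry-isPolynomial : ∀ {n} (i j : Fin n) → IsPolynomial (λ Z → Z i j)
  entry-isPolynomial i j with symmetric-coordinate i j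
  ... | t , t-coordinate with upperTriangle-isPolynomial t
  ...   | p , p≈Zₜ = p , λ Z sym-Z → trans (p≈Zₜ Z sym-Z) (t-coordinate Z sym-Z)

  -- Existence of the inverted polynomial.

  module _ {n : ℕ} (d : ℕ) (f : SymPolynomial n) where

    -- det(Z)^d (-Z⁻¹)^α = det(Z)^(d - |α|) (-adj Z)^α is a polynomial if
    -- |α| ≤ d.  For |α| > d the subtraction is truncated and the value is
    -- irrelevant, because the coefficient of x^α in f vanishes.
    inversionWeight : Matrix Carrier n → Exponent (triangle n) → Carrier
    inversionWeight Z α =
      det Z ^ (d ∸ ∣ α ∣) * monomial α (λ t → - uncurry (adjugate Z) (position t))

    inversion-isPolynomial : IsPolynomial (λ Z → weightedSum (inversionWeight Z) f)
    inversion-isPolynomial = weightedSum-isPolynomial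
      (λ α → *-isPolynomial
        (^-isPolynomial (d ∸ ∣ α ∣) (det-isPolynomial entry-isPolynomial))
        (product-isPolynomial (λ t → ^-isPolynomial (Vec.lookup α t) (neg-isPolynomial
          (adjugate-isPolynomial entry-isPolynomial _ _)))))
      f

    -- The monomial is homogeneous of degree |α|, so it absorbs |α| factors det(Z), one for each
    -- entry of -Z⁻¹, turning that entry into one of -adj(Z).
    inversionWeight-correct : ∀ {Z Z⁻¹} → Inverse Z Z⁻¹ → ∀ α → ∣ α ∣ ≤ d →
      det Z ^ d * monomial α (upperTriangle (negate Z⁻¹)) ≈ inversionWeight Z α
    inversionWeight-correct {Z} {Z⁻¹} inverse α ∣α∣≤d = begin
      det Z ^ d * monomial α y
        ≈⟨ *-congʳ (^-congʳ (det Z) (≡.sym (ℕ.m∸n+n≡m ∣α∣≤d))) ⟩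
      det Z ^ (d ∸ ∣ α ∣ ℕ.+ ∣ α ∣) * monomial α y
        ≈⟨ *-congʳ (^-homo-* (det Z) (d ∸ ∣ α ∣) ∣ α ∣) ⟩
      det Z ^ (d ∸ ∣ α ∣) * det Z ^ ∣ α ∣ * monomial α y
        ≈⟨ *-assoc _ _ _ ⟩
      det Z ^ (d ∸ ∣ α ∣) * (det Z ^ ∣ α ∣ * monomial α y)
        ≈⟨ *-congˡ (monomial-scale (det Z) α y) ⟩
      det Z ^ (d ∸ ∣ α ∣) * monomial α (λ t → det Z * y t)
        ≈⟨ *-congˡ (monomial-cong α cramer) ⟩
      inversionWeight Z α ∎
      where
      y : Vector Carrier (triangle n)
      y = upperTriangle (negate Z⁻¹)
      cramer : ∀ t → det Z * y t ≈ - uncurry (adjugate Z) (position t)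
      cramer t = begin
        det Z * y t                             ≈⟨ *-congˡ (reflexive (upperTriangle-position (negate Z⁻¹) t)) ⟩
        det Z * - uncurry Z⁻¹ (position t)      ≈⟨ -‿distribʳ-* _ _ ⟨
        - (det Z * uncurry Z⁻¹ (position t))    ≈⟨ -‿cong (adjugate≈det*inverse Z Z⁻¹ inverse _ _) ⟨
        - uncurry (adjugate Z) (position t)     ∎

    inversion-exists : (∀ α → d ℕ.< ∣ α ∣ → coefficient f α ≈ 0#) →
      ∃[ g ] IsInversion n d f g
    inversion-exists high≈0 with inversion-isPolynomial
    ... | g , g-correct = g , λ Z Z⁻¹ sym-Z inverse → begin
      g at Z
        ≈⟨ g-correct Z sym-Z ⟩
      weightedSum (inversionWeight Z) f
        ≈⟨ weightedSum-cong f (λ α → agree Z Z⁻¹ inverse α (∣ α ∣ ℕ.≤? d)) ⟨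
      weightedSum (λ α → det Z ^ d * monomial α (upperTriangle (negate Z⁻¹))) f
        ≈⟨ weightedSum-distribˡ (det Z ^ d) _ f ⟨
      det Z ^ d * weightedSum (λ α → monomial α (upperTriangle (negate Z⁻¹))) f
        ≈⟨ *-congˡ (evaluate≈weightedSum f _) ⟨
      det Z ^ d * f at (negate Z⁻¹) ∎
      where
      agree : ∀ Z Z⁻¹ → Inverse Z Z⁻¹ → ∀ α → Dec (∣ α ∣ ≤ d) →
        coefficient f α * (det Z ^ d * monomial α (upperTriangle (negate Z⁻¹)))
          ≈ coefficient f α * inversionWeight Z α
      agree Z Z⁻¹ inverse α (yes ∣α∣≤d) = *-congˡ (inversionWeight-correct inverse α ∣α∣≤d)
      agree Z Z⁻¹ inverse α (no ∣α∣≰d)  = trans (vanish _) (sym (vanish _))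
        where
        vanish : ∀ x → coefficient f α * x ≈ 0#
        vanish x = trans (*-congʳ (high≈0 α (ℕ.≰⇒> ∣α∣≰d))) (zeroˡ x)

-- Bilinear forms over a commutative ring.

module BilinearForms {c ℓ} (R : CommutativeRing c ℓ) where
  open CommutativeRing R hiding (zero)
  open MatricesAndPolynomials rawRing using (Symmetric)
  open Summation semiring
  open RingProperties ring using (-1*x≈-x)
  open SemiringSolver commutativeSemiring using (solve; _:=_; _:*_)
  open ≈-Reasoning setoid

  -- Bracketed as in `PositiveDefinite`, so that the form there is `bilinear B x x` by definition.
  bilinear : ∀ {n} → Matrix Carrier n → Vector Carrier n → Vector Carrier n → Carrier
  bilinear B x y = sum (λ i → sum (λ j → x i * B i j * y j))

  sum-zero : ∀ {n} {x : Vector Carrier n} → (∀ i → x i ≈ 0#) → sum x ≈ 0#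
  sum-zero {n} x≈0 = trans (sum-cong-≋ x≈0) (sum-replicate-zero n)

  sum-distrib-neg : ∀ {n} (x : Vector Carrier n) → sum (λ i → - x i) ≈ - sum x
  sum-distrib-neg x = begin
    sum (λ i → - x i)       ≈⟨ sum-cong-≋ (λ i → -1*x≈-x (x i)) ⟨
    sum (λ i → - 1# * x i)  ≈⟨ *-distribˡ-sum (- 1#) x ⟨
    - 1# * sum x            ≈⟨ -1*x≈-x (sum x) ⟩
    - sum x                 ∎

  sum-distrib-minus : ∀ {n} (x y : Vector Carrier n) → sum (λ i → x i - y i) ≈ sum x - sum y
  sum-distrib-minus x y = trans (∑-distrib-+ x (λ i → - y i)) (+-congˡ (sum-distrib-neg y))

  bilinear-apply : ∀ {n} (B : Matrix Carrier n) x y →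
    sum (λ i → x i * sum (λ j → B i j * y j)) ≈ bilinear B x y
  bilinear-apply B x y = sum-cong-≋ (λ i → trans
    (*-distribˡ-sum (x i) (λ j → B i j * y j))
    (sum-cong-≋ (λ j → sym (*-assoc (x i) (B i j) (y j)))))

  bilinear-symmetric : ∀ {n} (B : Matrix Carrier n) → Symmetric B →
    ∀ x y → bilinear B x y ≈ bilinear B y x
  bilinear-symmetric B B-sym x y = trans
    (∑-comm (λ i j → x i * B i j * y j))
    (sum-cong-≋ (λ j → sum-cong-≋ (λ i → trans
      (solve 3 (λ a b c → a :* b :* c := c :* b :* a) refl (x i) (B i j) (y j))
      (*-congʳ (*-congˡ (B-sym i j))))))

  bilinear-0∷ : ∀ {n} (B : Matrix Carrier (suc n)) x y →
    bilinear B (0# Vector.∷ x) (0# Vector.∷ y)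
      ≈ bilinear (λ i j → B (suc i) (suc j)) x y
  bilinear-0∷ B x y = begin
    sum (λ j → 0# * B zero j * (0# Vector.∷ y) j)
      + sum (λ i → x i * B (suc i) zero * 0# + sum (λ j → x i * B (suc i) (suc j) * y j))
      ≈⟨ +-cong
           (sum-zero (λ j → trans (*-congʳ (zeroˡ (B zero j))) (zeroˡ ((0# Vector.∷ y) j))))
           (sum-cong-≋ (λ i → trans (+-congʳ (zeroʳ (x i * B (suc i) zero))) (+-identityˡ _))) ⟩
    0# + bilinear (λ i j → B (suc i) (suc j)) x y
      ≈⟨ +-identityˡ _ ⟩
    bilinear (λ i j → B (suc i) (suc j)) x y ∎

-- Apartness and sign in the real field.

module OrderedField {c ℓ₁ ℓ₂} (ℝ : Reals c ℓ₁ ℓ₂) where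
  open Reals ℝ using (_<_; _#_; isHeytingField; isStrictPartialOrder; +-monoˡ-<; *-positive)

  heytingField : HeytingField c ℓ₁ ℓ₂
  heytingField = record { isHeytingField = isHeytingField }

  open HeytingField heytingField public using (heytingCommutativeRing; #⇒invertible; #-cotrans; tight)
  open HeytingProperties heytingCommutativeRing public using (1#0; invertibleˡ⇒#; #-congʳ; x-0≈x)

  real : CommutativeRing c ℓ₁
  real = HeytingCommutativeRing.commutativeRing heytingCommutativeRing

  open CommutativeRing real hiding (zero)
  open Summation semiring using (sum)
  open RingProperties ring
  open BilinearForms real
  open ≈-Reasoning setoid
  open IsStrictPartialOrder isStrictPartialOrder public
    using (irrefl; <-respʳ-≈; <-respˡ-≈) renaming (trans to <-trans)

  private variable
    x y : Carrier

  ¬#⇒≈ : ¬ (x # y) → x ≈ y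
  ¬#⇒≈ {x} {y} = proj₁ (tight x y)

  ≈⇒¬# : x ≈ y → ¬ (x # y)
  ≈⇒¬# {x} {y} = proj₂ (tight x y)

  x+y-x≈y : ∀ x y → x + y - x ≈ y
  x+y-x≈y x y = begin
    x + y - x      ≈⟨ +-congʳ (+-comm x y) ⟩
    y + x - x      ≈⟨ +-assoc y x (- x) ⟩
    y + (x - x)    ≈⟨ +-congˡ (-‿inverseʳ x) ⟩
    y + 0#         ≈⟨ +-identityʳ y ⟩
    y              ∎

  x+y<x⇒y<0 : x + y < x → y < 0#
  x+y<x⇒y<0 {x} {y} x+y<x =
    <-respʳ-≈ (-‿inverseʳ x) (<-respˡ-≈ (x+y-x≈y x y) (+-monoˡ-< (- x) x+y<x))

  x<x+y⇒0<y : x < x + y → 0# < y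
  x<x+y⇒0<y {x} {y} x<x+y =
    <-respʳ-≈ (x+y-x≈y x y) (<-respˡ-≈ (-‿inverseʳ x) (+-monoˡ-< (- x) x<x+y))

  x+y#x⇒y#0 : (x + y) # x → y # 0#
  x+y#x⇒y#0 (inj₁ x+y<x) = inj₁ (x+y<x⇒y<0 x+y<x)
  x+y#x⇒y#0 (inj₂ x<x+y) = inj₂ (x<x+y⇒0<y x<x+y)

  -- Cotransitivity with x as the intermediate point: x + y is apart from x, or x is apart from 0.
  +-#0 : (x + y) # 0# → x # 0# ⊎ y # 0#
  +-#0 {x} x+y#0 with #-cotrans x+y#0 x
  ... | inj₁ x+y#x = inj₂ (x+y#x⇒y#0 x+y#x)
  ... | inj₂ x#0   = inj₁ x#0

  sum-#0 : ∀ {n} (x : Vector Carrier n) → sum x # 0# → ∃[ i ] (x i # 0#)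
  sum-#0 {zero}  x 0#0   = contradiction 0#0 (≈⇒¬# refl)
  sum-#0 {suc n} x sum#0 with +-#0 sum#0
  ... | inj₁ head#0 = zero , head#0
  ... | inj₂ tail#0 with sum-#0 (tail x) tail#0
  ...   | i , xᵢ#0 = suc i , xᵢ#0

  inverse : x # 0# → ∃[ y ] (y * x ≈ 1#)
  inverse {x} x#0 with #⇒invertible x#0
  ... | y , y[x-0]≈1 , _ = y , trans (*-congˡ (sym (x-0≈x x))) y[x-0]≈1

  -- An inverse of x y, multiplied by x, is an inverse of y, and invertible elements are apart from
  -- 0.
  *-#0ʳ : (x * y) # 0# → y # 0#
  *-#0ʳ {x} {y} xy#0 with inverse xy#0
  ... | z , z[xy]≈1 = invertibleˡ⇒#
    (z * x , trans (*-congˡ (x-0≈x y)) (trans (*-assoc z x y) z[xy]≈1))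

  square-positive : x # 0# → 0# < x * x
  square-positive {x} (inj₂ 0<x) = *-positive 0<x 0<x
  square-positive {x} (inj₁ x<0) = <-respʳ-≈ -x*-x≈x*x (*-positive 0<-x 0<-x)
    where
    0<-x : 0# < - x
    0<-x = <-respʳ-≈ (+-identityˡ (- x)) (<-respˡ-≈ (-‿inverseʳ x) (+-monoˡ-< (- x) x<0))
    -x*-x≈x*x : - x * - x ≈ x * x
    -x*-x≈x*x = begin
      - x * - x      ≈⟨ -‿distribˡ-* x (- x) ⟨
      - (x * - x)    ≈⟨ -‿cong (-‿distribʳ-* x x) ⟨
      - - (x * x)    ≈⟨ -‿involutive (x * x) ⟩
      x * x          ∎

  -- Cotransitivity places x + y apart from 0 or apart from x. A negative x + y would force y < 0,
  -- and x + y apart from x makes y apart from 0, hence positive.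
  positive+nonNegative : 0# < x → ¬ (y < 0#) → 0# < x + y
  positive+nonNegative {x} {y} 0<x y≮0 with #-cotrans (inj₁ 0<x) (x + y)
  ... | inj₁ (inj₁ 0<x+y)  = 0<x+y
  ... | inj₁ (inj₂ x+y<0)  = contradiction (x+y<x⇒y<0 (<-trans x+y<0 0<x)) y≮0
  ... | inj₂ x+y#x with x+y#x⇒y#0 x+y#x
  ...   | inj₁ y<0 = contradiction y<0 y≮0
  ...   | inj₂ 0<y = <-trans 0<x (<-respˡ-≈ (+-identityʳ x) (<-respʳ-≈ (+-comm y x)
                       (<-respˡ-≈ (trans (+-identityˡ x) (sym (+-identityʳ x))) (+-monoˡ-< x 0<y))))

  nonNegative+positive : ¬ (x < 0#) → 0# < y → 0# < x + y
  nonNegative+positive {x} {y} x≮0 0<y =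
    <-respʳ-≈ (+-comm y x) (positive+nonNegative 0<y x≮0)

  -- A negative square would make x apart from 0, and then the square is positive.
  square-nonNegative : ∀ x → ¬ (x * x < 0#)
  square-nonNegative x x²<0 =
    irrefl refl (<-trans (square-positive (*-#0ʳ (inj₁ x²<0))) x²<0)

-- The complex field.

module ComplexNumbers {c ℓ₁ ℓ₂} (ℝ : Reals c ℓ₁ ℓ₂) where
  open OrderedField ℝ
  open Reals ℝ using (_<_; _#_)
  open Complex ℝ
  open CommutativeRing real hiding (zero)
  open Summation semiring
  open RingProperties ring
  open SemiringSolver commutativeSemiring using (solve; _:=_; _:+_; _:*_; con)
  open BilinearForms real
  open ≈-Reasoning setoid
  private
    module ℂᴿ = RawRing ℂ-rawRing

    -- Removes subtraction, so that the semiring solver applies with `- 1#` as a variable.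
    x-y≈x+m*y : ∀ x y → x - y ≈ x + - 1# * y
    x-y≈x+m*y x y = +-congˡ (sym (-1*x≈-x y))

    +-abelianGroupℂ : AbelianGroup c ℓ₁
    +-abelianGroupℂ = DirectProduct.abelianGroup +-abelianGroup +-abelianGroup

    open AlgebraDefinitions ℂᴿ._≈_
      using (Congruent₂; Commutative; Associative; LeftIdentity; _DistributesOverˡ_)

    *-congℂ : Congruent₂ ℂᴿ._*_
    *-congℂ (a≈ , b≈) (x≈ , y≈) =
      +-cong (*-cong a≈ x≈) (-‿cong (*-cong b≈ y≈)) , +-cong (*-cong a≈ y≈) (*-cong b≈ x≈)

    *-commℂ : Commutative ℂᴿ._*_
    *-commℂ (a , b) (x , y) = +-cong (*-comm a x) (-‿cong (*-comm b y)) ,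
      solve 4 (λ a b x y → a :* y :+ b :* x := x :* b :+ y :* a) refl a b x y

    *-assocℂ : Associative ℂᴿ._*_
    *-assocℂ (a , b) (p , q) (x , y) = (begin
      (a * p - b * q) * x - (a * q + b * p) * y
        ≈⟨ trans (x-y≈x+m*y _ _) (+-congʳ (*-congʳ (x-y≈x+m*y _ _))) ⟩
      (a * p + m * (b * q)) * x + m * ((a * q + b * p) * y)
        ≈⟨ solve 7 (λ m a b p q x y →
             (a :* p :+ m :* (b :* q)) :* x :+ m :* ((a :* q :+ b :* p) :* y)
             := a :* (p :* x :+ m :* (q :* y)) :+ m :* (b :* (p :* y :+ q :* x)))
           refl m a b p q x y ⟩
      a * (p * x + m * (q * y)) + m * (b * (p * y + q * x))
        ≈⟨ trans (x-y≈x+m*y _ _) (+-congʳ (*-congˡ (x-y≈x+m*y _ _))) ⟨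
      a * (p * x - q * y) - b * (p * y + q * x) ∎) , (begin
      (a * p - b * q) * y + (a * q + b * p) * x
        ≈⟨ +-congʳ (*-congʳ (x-y≈x+m*y _ _)) ⟩
      (a * p + m * (b * q)) * y + (a * q + b * p) * x
        ≈⟨ solve 7 (λ m a b p q x y →
             (a :* p :+ m :* (b :* q)) :* y :+ (a :* q :+ b :* p) :* x
             := a :* (p :* y :+ q :* x) :+ b :* (p :* x :+ m :* (q :* y)))
           refl m a b p q x y ⟩
      a * (p * y + q * x) + b * (p * x + m * (q * y))
        ≈⟨ +-congˡ (*-congˡ (x-y≈x+m*y _ _)) ⟨
      a * (p * y + q * x) + b * (p * x - q * y) ∎)
      where m = - 1#

    *-identityˡℂ : LeftIdentity ℂᴿ.1# ℂᴿ._*_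
    *-identityˡℂ (x , y) = (begin
      1# * x - 0# * y         ≈⟨ x-y≈x+m*y _ _ ⟩
      1# * x + - 1# * (0# * y) ≈⟨ solve 3 (λ m x y → con 1 :* x :+ m :* (con 0 :* y) := x) refl (- 1#) x y ⟩
      x                       ∎) ,
      solve 2 (λ x y → con 1 :* y :+ con 0 :* x := y) refl x y

    distribˡℂ : ℂᴿ._*_ DistributesOverˡ ℂᴿ._+_
    distribˡℂ (a , b) (p , q) (x , y) = (begin
      a * (p + x) - b * (q + y)
        ≈⟨ x-y≈x+m*y _ _ ⟩
      a * (p + x) + m * (b * (q + y))
        ≈⟨ solve 7 (λ m a b p q x y →
             a :* (p :+ x) :+ m :* (b :* (q :+ y))
             := (a :* p :+ m :* (b :* q)) :+ (a :* x :+ m :* (b :* y)))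
           refl m a b p q x y ⟩
      (a * p + m * (b * q)) + (a * x + m * (b * y))
        ≈⟨ +-cong (x-y≈x+m*y _ _) (x-y≈x+m*y _ _) ⟨
      (a * p - b * q) + (a * x - b * y) ∎) ,
      solve 6 (λ a b p q x y →
        a :* (q :+ y) :+ b :* (p :+ x) := (a :* q :+ b :* p) :+ (a :* y :+ b :* x))
        refl a b p q x y
      where m = - 1#

  complex : CommutativeRing c ℓ₁
  complex = record
    { isCommutativeRing = record
      { isRing = record
        { +-isAbelianGroup = AbelianGroup.isAbelianGroup +-abelianGroupℂ
        ; *-cong           = *-congℂ
        ; *-assoc          = *-assocℂ
        ; *-identity       = comm∧idˡ⇒id *-commℂ *-identityˡℂ
        ; distrib          = comm∧distrˡ⇒distr (AbelianGroup.∙-cong +-abelianGroupℂ) *-commℂ distribˡℂ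
        }
      ; *-comm = *-commℂ
      }
    }
    where open SetoidConsequences (AbelianGroup.setoid +-abelianGroupℂ)

  private
    module ℂᶜ = CommutativeRing complex
    module ℂˢ = Summation ℂᶜ.semiring
    module ≈ᶜ = ≈-Reasoning ℂᶜ.setoid
    module ℂᵉ = Exp ℂᶜ.commutativeSemiring
  open Determinant complex using (adjugate; ⊗-adjugate; ⊗-apply-assoc; sum-identityˡ;
    rightInverse-symmetric; symmetric-rightInverse)

  -- The inverse of a + ib is (a - ib) / (a² + b²); one coordinate apart from 0 already makes the
  -- denominator positive.
  ℂ-inverse : ∀ {z : ℂ} → proj₁ z # 0# ⊎ proj₂ z # 0# → ∃[ w ] (z ℂᴿ.* w ℂᴿ.≈ ℂᴿ.1#)
  ℂ-inverse {a , b} z#0 with inverse (inj₂ (∣z∣²>0 z#0))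
    where
    ∣z∣²>0 : a # 0# ⊎ b # 0# → 0# < a * a + b * b
    ∣z∣²>0 (inj₁ a#0) = positive+nonNegative (square-positive a#0) (square-nonNegative b)
    ∣z∣²>0 (inj₂ b#0) = nonNegative+positive (square-nonNegative a) (square-positive b#0)
  ... | r , r∣z∣²≈1 = (a * r , - (b * r)) , (begin
    a * (a * r) - b * - (b * r)
      ≈⟨ +-congˡ (trans (-‿cong (sym (-‿distribʳ-* b (b * r)))) (-‿involutive _)) ⟩
    a * (a * r) + b * (b * r)
      ≈⟨ solve 3 (λ a b r → a :* (a :* r) :+ b :* (b :* r) := r :* (a :* a :+ b :* b)) refl a b r ⟩
    r * (a * a + b * b)
      ≈⟨ r∣z∣²≈1 ⟩
    1# ∎) , (begin
    a * - (b * r) + b * (a * r)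
      ≈⟨ +-cong (sym (-‿distribʳ-* a (b * r)))
           (solve 3 (λ a b r → b :* (a :* r) := a :* (b :* r)) refl a b r) ⟩
    - (a * (b * r)) + a * (b * r)
      ≈⟨ -‿inverseˡ _ ⟩
    0# ∎)

  ℂ-¬#0⇒≈0 : ∀ {z : ℂ} → ¬ (proj₁ z # 0# ⊎ proj₂ z # 0#) → z ℂᴿ.≈ ℂᴿ.0#
  ℂ-¬#0⇒≈0 ¬z#0 = ¬#⇒≈ (¬z#0 ∘ inj₁) , ¬#⇒≈ (¬z#0 ∘ inj₂)

  proj₁-sum : ∀ {n} (z : Vector ℂ n) → proj₁ (ℂˢ.sum z) ≡ sum (proj₁ ∘ z)
  proj₁-sum {zero}  z = ≡.refl
  proj₁-sum {suc n} z = ≡.cong (proj₁ (z zero) +_) (proj₁-sum (tail z))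

  proj₂-sum : ∀ {n} (z : Vector ℂ n) → proj₂ (ℂˢ.sum z) ≡ sum (proj₂ ∘ z)
  proj₂-sum {zero}  z = ≡.refl
  proj₂-sum {suc n} z = ≡.cong (proj₂ (z zero) +_) (proj₂-sum (tail z))

  -- Matrices with positive definite imaginary part.

  infixl 7 _·_
  _·_ : ∀ {n} → Matrix ℂ n → Vector ℂ n → Vector ℂ n
  (M · w) i = ℂˢ.sum (λ j → M i j ℂᴿ.* w j)

  quadratic : ∀ {n} → Matrix Carrier n → Vector Carrier n → Carrier
  quadratic B x = bilinear B x x

  -- Im (w* M w) = w* (Im M) w for complex symmetric M, with w* split into
  -- its real and imaginary parts.
  Im-w*Mw : ∀ {n} (M : Matrix ℂ n) → Symmetric M → ∀ (w : Vector ℂ n) →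
    sum (λ i → proj₁ (w i) * proj₂ ((M · w) i)) - sum (λ i → proj₂ (w i) * proj₁ ((M · w) i))
      ≈ quadratic (Im M) (proj₁ ∘ w) + quadratic (Im M) (proj₂ ∘ w)
  Im-w*Mw M M-sym w = begin
    sum (λ i → u i * proj₂ ((M · w) i)) - sum (λ i → v i * proj₁ ((M · w) i))
      ≈⟨ +-cong u-part (-‿cong v-part) ⟩
    (bilinear A u v + quadratic B u) - (bilinear A v u - quadratic B v)
      ≈⟨ +-cong (+-congʳ (bilinear-symmetric A (λ i j → proj₁ (M-sym i j)) u v))
                (trans (sym (-‿+-comm _ _)) (+-congˡ (-‿involutive _))) ⟩
    (bilinear A v u + quadratic B u) + (- bilinear A v u + quadratic B v)
      ≈⟨ solve 4 (λ p q r s → (p :+ q) :+ (r :+ s) := (p :+ r) :+ (q :+ s)) refl _ _ _ _ ⟩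
    (bilinear A v u - bilinear A v u) + (quadratic B u + quadratic B v)
      ≈⟨ trans (+-congʳ (-‿inverseʳ _)) (+-identityˡ _) ⟩
    quadratic B u + quadratic B v ∎
    where
    A = λ i j → proj₁ (M i j)
    B = Im M
    u = proj₁ ∘ w
    v = proj₂ ∘ w
    u-part : sum (λ i → u i * proj₂ ((M · w) i)) ≈ bilinear A u v + quadratic B u
    u-part = begin
      sum (λ i → u i * proj₂ ((M · w) i))
        ≈⟨ sum-cong-≋ (λ i → *-congˡ (trans
             (reflexive (proj₂-sum (λ j → M i j ℂᴿ.* w j)))
             (∑-distrib-+ (λ j → A i j * v j) (λ j → B i j * u j)))) ⟩
      sum (λ i → u i * (sum (λ j → A i j * v j) + sum (λ j → B i j * u j)))
        ≈⟨ sum-cong-≋ (λ i → distribˡ (u i) (sum (λ j → A i j * v j)) (sum (λ j → B i j * u j))) ⟩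
      sum (λ i → u i * sum (λ j → A i j * v j) + u i * sum (λ j → B i j * u j))
        ≈⟨ ∑-distrib-+ (λ i → u i * sum (λ j → A i j * v j)) (λ i → u i * sum (λ j → B i j * u j)) ⟩
      sum (λ i → u i * sum (λ j → A i j * v j)) + sum (λ i → u i * sum (λ j → B i j * u j))
        ≈⟨ +-cong (bilinear-apply A u v) (bilinear-apply B u u) ⟩
      bilinear A u v + quadratic B u ∎
    v-part : sum (λ i → v i * proj₁ ((M · w) i)) ≈ bilinear A v u - quadratic B v
    v-part = begin
      sum (λ i → v i * proj₁ ((M · w) i))
        ≈⟨ sum-cong-≋ (λ i → *-congˡ (trans
             (reflexive (proj₁-sum (λ j → M i j ℂᴿ.* w j)))
             (sum-distrib-minus (λ j → A i j * u j) (λ j → B i j * v j)))) ⟩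
      sum (λ i → v i * (sum (λ j → A i j * u j) - sum (λ j → B i j * v j)))
        ≈⟨ sum-cong-≋ (λ i → x[y-z]≈xy-xz (v i) (sum (λ j → A i j * u j)) (sum (λ j → B i j * v j))) ⟩
      sum (λ i → v i * sum (λ j → A i j * u j) - v i * sum (λ j → B i j * v j))
        ≈⟨ sum-distrib-minus (λ i → v i * sum (λ j → A i j * u j)) (λ i → v i * sum (λ j → B i j * v j)) ⟩
      sum (λ i → v i * sum (λ j → A i j * u j)) - sum (λ i → v i * sum (λ j → B i j * v j))
        ≈⟨ +-cong (bilinear-apply A v u) (-‿cong (bilinear-apply B v v)) ⟩
      bilinear A v u - quadratic B v ∎

  -- A negative value is apart from 0, so some summand and with it some entry of x is apart from 0;
  -- positive definiteness then contradicts the sign.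
  quadratic-nonNegative : ∀ {n} {B : Matrix Carrier n} → PositiveDefinite B →
    ∀ x → ¬ (quadratic B x < 0#)
  quadratic-nonNegative {B = B} (_ , B-pos) x Q<0
    with sum-#0 (λ i → sum (λ j → x i * B i j * x j)) (inj₁ Q<0)
  ... | i , row#0 with sum-#0 (λ j → x i * B i j * x j) row#0
  ...   | j , term#0 = irrefl refl (<-trans (B-pos x (j , *-#0ʳ term#0)) Q<0)

  quadratic-pair-positive : ∀ {n} {B : Matrix Carrier n} → PositiveDefinite B →
    ∀ (w : Vector ℂ n) → ∃[ i ] (proj₁ (w i) # 0# ⊎ proj₂ (w i) # 0#) →
    0# < quadratic B (proj₁ ∘ w) + quadratic B (proj₂ ∘ w)
  quadratic-pair-positive B-pd w (i , inj₁ u#0) =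
    positive+nonNegative (proj₂ B-pd _ (i , u#0)) (quadratic-nonNegative B-pd _)
  quadratic-pair-positive B-pd w (i , inj₂ v#0) =
    nonNegative+positive (quadratic-nonNegative B-pd _) (proj₂ B-pd _ (i , v#0))

  -- Test vectors for the minor are padded with a leading 0.
  positiveDefinite-minor : ∀ {n} {B : Matrix Carrier (suc n)} → PositiveDefinite B →
    PositiveDefinite (λ i j → B (suc i) (suc j))
  positiveDefinite-minor {B = B} (B-sym , B-pos) =
    (λ i j → B-sym (suc i) (suc j)) ,
    λ x (i , xᵢ#0) → <-respʳ-≈ (bilinear-0∷ B x x) (B-pos (0# Vector.∷ x) (suc i , xᵢ#0))

  -- If det M = 0, then w, the first column of adj M, satisfies M w = 0, so
  -- w = 0 because w* (Im M) w = Im (w* M w) = 0.  But the first entry of w is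
  -- the determinant of a smaller matrix of the same kind.
  det≉0 : ∀ {n} (M : Matrix ℂ n) → Symmetric M → PositiveDefinite (Im M) →
    ¬ (det M ℂᴿ.≈ ℂᴿ.0#)
  det≉0 {zero}  M _     _    (1≈0 , _) = ≈⇒¬# 1≈0 1#0
  det≉0 {suc n} M M-sym M-pd det≈0     =
    det≉0 minor (λ i j → M-sym (suc i) (suc j)) (positiveDefinite-minor M-pd) minor≈0
    where
    minor : Matrix ℂ n
    minor i j = M (suc i) (suc j)
    w : Vector ℂ (suc n)
    w k = adjugate M k zero
    Mw≈0 : ∀ i → (M · w) i ℂᴿ.≈ ℂᴿ.0#
    Mw≈0 i = ℂᶜ.trans (⊗-adjugate M i zero)
      (ℂᶜ.trans (ℂᶜ.*-congʳ {identity i zero} det≈0) (ℂᶜ.zeroˡ (identity i zero)))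
    Q≈0 : quadratic (Im M) (proj₁ ∘ w) + quadratic (Im M) (proj₂ ∘ w) ≈ 0#
    Q≈0 = begin
      quadratic (Im M) (proj₁ ∘ w) + quadratic (Im M) (proj₂ ∘ w)
        ≈⟨ Im-w*Mw M M-sym w ⟨
      sum (λ i → proj₁ (w i) * proj₂ ((M · w) i)) - sum (λ i → proj₂ (w i) * proj₁ ((M · w) i))
        ≈⟨ +-cong (sum-zero (λ i → trans (*-congˡ (proj₂ (Mw≈0 i))) (zeroʳ (proj₁ (w i)))))
             (-‿cong (sum-zero (λ i → trans (*-congˡ (proj₁ (Mw≈0 i))) (zeroʳ (proj₂ (w i)))))) ⟩
      0# - 0#
        ≈⟨ -‿inverseʳ 0# ⟩
      0# ∎
    w₀≈minor : w zero ℂᴿ.≈ det minor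
    w₀≈minor = ℂᶜ.trans (ℂᶜ.*-identityˡ (ℂᴿ.1# ℂᴿ.* det minor)) (ℂᶜ.*-identityˡ (det minor))
    minor≈0 : det minor ℂᴿ.≈ ℂᴿ.0#
    minor≈0 = ℂᶜ.trans (ℂᶜ.sym w₀≈minor) (ℂ-¬#0⇒≈0 λ w₀#0 →
      irrefl (sym Q≈0) (quadratic-pair-positive M-pd w (zero , w₀#0)))

  -- Im (x* N x) = - Im (w* M w) for real x and w = N x.
  positiveDefinite-negateInverse : ∀ {n} {M N : Matrix ℂ n} → Symmetric M →
    PositiveDefinite (Im M) → Inverse M N → PositiveDefinite (Im (negate N))
  positiveDefinite-negateInverse {n} {M} {N} M-sym M-pd (MN≈1 , _) =
    (λ i j → -‿cong (proj₂ (rightInverse-symmetric M N M-sym MN≈1 i j))) , positive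
    where
    module _ (x : Vector Carrier n) where
      xᶜ w : Vector ℂ n
      xᶜ i = x i , 0#
      w = N · xᶜ

      Mw≈x : ∀ i → (M · w) i ℂᴿ.≈ xᶜ i
      Mw≈x i = ≈ᶜ.begin
        (M · w) i                             ≈ᶜ.≈⟨ ⊗-apply-assoc M N xᶜ i ⟨
        ℂˢ.sum (λ k → (M ⊗ N) i k ℂᴿ.* xᶜ k)  ≈ᶜ.≈⟨ ℂˢ.sum-cong-≋ (λ k → ℂᶜ.*-congʳ {xᶜ k} (MN≈1 i k)) ⟩
        ℂˢ.sum (λ k → identity i k ℂᴿ.* xᶜ k) ≈ᶜ.≈⟨ sum-identityˡ i xᶜ ⟩
        xᶜ i                                  ≈ᶜ.∎

      Im-w : ∀ i → proj₂ (w i) ≈ sum (λ j → Im N i j * x j)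
      Im-w i = trans (reflexive (proj₂-sum (λ j → N i j ℂᴿ.* xᶜ j)))
        (sum-cong-≋ (λ j → trans (+-congʳ (zeroʳ (proj₁ (N i j)))) (+-identityˡ _)))

      quadratic-negateInverse : quadratic (Im M) (proj₁ ∘ w) + quadratic (Im M) (proj₂ ∘ w)
        ≈ quadratic (Im (negate N)) x
      quadratic-negateInverse = begin
        quadratic (Im M) (proj₁ ∘ w) + quadratic (Im M) (proj₂ ∘ w)
          ≈⟨ Im-w*Mw M M-sym w ⟨
        sum (λ i → proj₁ (w i) * proj₂ ((M · w) i)) - sum (λ i → proj₂ (w i) * proj₁ ((M · w) i))
          -- M w = x is real, so the first sum vanishes and only Im w = (Im N) x enters the second.
          ≈⟨ +-cong (sum-zero (λ i → trans (*-congˡ (proj₂ (Mw≈x i))) (zeroʳ (proj₁ (w i)))))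
               (-‿cong (sum-cong-≋ (λ i → *-cong (Im-w i) (proj₁ (Mw≈x i))))) ⟩
        0# - sum (λ i → sum (λ j → Im N i j * x j) * x i)
          ≈⟨ +-identityˡ _ ⟩
        - sum (λ i → sum (λ j → Im N i j * x j) * x i)
          ≈⟨ sum-distrib-neg (λ i → sum (λ j → Im N i j * x j) * x i) ⟨
        sum (λ i → - (sum (λ j → Im N i j * x j) * x i))
          ≈⟨ sum-cong-≋ (λ i → trans (-‿cong (*-comm _ (x i))) (-‿distribʳ-* (x i) _)) ⟩
        sum (λ i → x i * - sum (λ j → Im N i j * x j))
          ≈⟨ sum-cong-≋ (λ i → *-congˡ (trans
               (sym (sum-distrib-neg (λ j → Im N i j * x j)))
               (sum-cong-≋ (λ j → -‿distribˡ-* (Im N i j) (x j))))) ⟩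
        sum (λ i → x i * sum (λ j → Im (negate N) i j * x j))
          ≈⟨ bilinear-apply (Im (negate N)) x x ⟩
        quadratic (Im (negate N)) x ∎

      term : Fin n → Fin n → Carrier
      term i j = proj₁ (M i j ℂᴿ.* w j)

      term#0⇒w#0 : ∀ i j → term i j # 0# → proj₁ (w j) # 0# ⊎ proj₂ (w j) # 0#
      term#0⇒w#0 i j = Sum.map *-#0ʳ (*-#0ʳ ∘ #-congʳ (-‿distribˡ-* (Im M i j) (proj₂ (w j)))) ∘ +-#0

      x≈sum-term : ∀ i → x i ≈ sum (term i)
      x≈sum-term i = begin
        x i               ≈⟨ proj₁ (Mw≈x i) ⟨
        proj₁ ((M · w) i) ≡⟨ proj₁-sum (λ j → M i j ℂᴿ.* w j) ⟩
        sum (term i)      ∎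

      -- Positivity needs an explicit index. As x = M w, an entry of x apart from 0 is a sum with a
      -- summand apart from 0, and that summand contains the required entry of w.
      w#0 : ∃[ i ] (x i # 0#) → ∃[ j ] (proj₁ (w j) # 0# ⊎ proj₂ (w j) # 0#)
      w#0 (i , xᵢ#0) = Product.map₂ (term#0⇒w#0 i _) (sum-#0 (term i) (#-congʳ (x≈sum-term i) xᵢ#0))

    positive : ∀ x → ∃[ i ] (x i # 0#) → 0# < quadratic (Im (negate N)) x
    positive x x#0 = <-respʳ-≈ (quadratic-negateInverse x)
      (quadratic-pair-positive M-pd (w x) (w#0 x x#0))

  -- Cramer's rule with e for 1 / det M gives the right inverse; symmetry of M makes it two-sided.
  inverse-from-det : ∀ {n} (M : Matrix ℂ n) → Symmetric M →
    ∀ {e} → det M ℂᴿ.* e ℂᴿ.≈ ℂᴿ.1# → ∃[ N ] Inverse M N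
  inverse-from-det M M-sym {e} det*e≈1 = N , symmetric-rightInverse M N M-sym MN≈1
    where
    N : Matrix ℂ _
    N i j = adjugate M i j ℂᴿ.* e
    MN≈1 : ∀ i j → (M ⊗ N) i j ℂᴿ.≈ identity i j
    MN≈1 i j = ≈ᶜ.begin
      ℂˢ.sum (λ k → M i k ℂᴿ.* (adjugate M k j ℂᴿ.* e))
        ≈ᶜ.≈⟨ ℂˢ.sum-cong-≋ (λ k → ℂᶜ.*-assoc (M i k) (adjugate M k j) e) ⟨
      ℂˢ.sum (λ k → M i k ℂᴿ.* adjugate M k j ℂᴿ.* e)
        ≈ᶜ.≈⟨ ℂˢ.*-distribʳ-sum e (λ k → M i k ℂᴿ.* adjugate M k j) ⟨
      (M ⊗ adjugate M) i j ℂᴿ.* e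
        ≈ᶜ.≈⟨ ℂᶜ.*-congʳ {e} (⊗-adjugate M i j) ⟩
      det M ℂᴿ.* identity i j ℂᴿ.* e
        ≈ᶜ.≈⟨ ℂᶜ.trans (ℂᶜ.*-assoc (det M) (identity i j) e) (ℂᶜ.trans
             (ℂᶜ.*-congˡ {det M} (ℂᶜ.*-comm (identity i j) e))
             (ℂᶜ.sym (ℂᶜ.*-assoc (det M) e (identity i j)))) ⟩
      det M ℂᴿ.* e ℂᴿ.* identity i j
        ≈ᶜ.≈⟨ ℂᶜ.*-congʳ {identity i j} det*e≈1 ⟩
      ℂᴿ.1# ℂᴿ.* identity i j
        ≈ᶜ.≈⟨ ℂᶜ.*-identityˡ (identity i j) ⟩
      identity i j ≈ᶜ.∎

  -- Each factor z is removed by multiplying with its inverse e.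
  cancel-power : ∀ d {z e y : ℂ} → z ℂᴿ.* e ℂᴿ.≈ ℂᴿ.1# →
    z ℂᵉ.^ d ℂᴿ.* y ℂᴿ.≈ ℂᴿ.0# → y ℂᴿ.≈ ℂᴿ.0#
  cancel-power zero    {y = y}         ze≈1 y≈0    = ℂᶜ.trans (ℂᶜ.sym (ℂᶜ.*-identityˡ y)) y≈0
  cancel-power (suc d) {z} {e} {y} ze≈1 zzᵈy≈0 = cancel-power d ze≈1 (≈ᶜ.begin
    p                                ≈ᶜ.≈⟨ ℂᶜ.*-identityˡ p ⟨
    ℂᴿ.1# ℂᴿ.* p                     ≈ᶜ.≈⟨ ℂᶜ.*-congʳ {p} (ℂᶜ.trans (ℂᶜ.*-comm e z) ze≈1) ⟨
    e ℂᴿ.* z ℂᴿ.* p                  ≈ᶜ.≈⟨ ℂᶜ.*-assoc e z p ⟩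
    e ℂᴿ.* (z ℂᴿ.* p)                ≈ᶜ.≈⟨ ℂᶜ.*-congˡ {e} (ℂᶜ.*-assoc z (z ℂᵉ.^ d) y) ⟨
    e ℂᴿ.* (z ℂᵉ.^ suc d ℂᴿ.* y)     ≈ᶜ.≈⟨ ℂᶜ.*-congˡ {e} zzᵈy≈0 ⟩
    e ℂᴿ.* ℂᴿ.0#                     ≈ᶜ.≈⟨ ℂᶜ.zeroʳ e ⟩
    ℂᴿ.0#                            ≈ᶜ.∎)
    where
    p = z ℂᵉ.^ d ℂᴿ.* y

  inversion-psdStable : ∀ {n d} {f g : SymPolynomial n} → PSDStable n f →
    IsInversion n d f g → PSDStable n g
  inversion-psdStable {n} {d} {f} {g} f-stable g-inversion M M-sym M-pd g≈0 =
    -- A contradiction is sought, so det M may be assumed apart from 0: were that impossible,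
    -- tightness would make it 0, against `det≉0`. The assumption provides the inverse of M at which
    -- `IsInversion` can be applied.
    det≉0 M M-sym M-pd (ℂ-¬#0⇒≈0 λ det#0 →
      let e , det*e≈1 = ℂ-inverse det#0
          N , MN-inverse = inverse-from-det M M-sym det*e≈1
          -N-pd = positiveDefinite-negateInverse M-sym M-pd MN-inverse
          N-sym = rightInverse-symmetric M N M-sym (proj₁ MN-inverse)
      in f-stable (negate N) (λ i j → ℂᶜ.-‿cong (N-sym i j)) -N-pd
           (cancel-power d det*e≈1 (ℂᶜ.trans (ℂᶜ.sym (g-inversion M N M-sym MN-inverse)) g≈0)))

theorem4p3 : ∀ {c ℓ₁ ℓ₂} (ℝ : Reals c ℓ₁ ℓ₂) → let open Complex ℝ in
    (n : ℕ) → 1 ≤ n →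
    (f : SymPolynomial n) → PSDStable n f →
    (d : ℕ) → IsTotalDegree f d →
    (∃[ g ] IsInversion n d f g)
    × (∀ g → IsInversion n d f g → PSDStable n g)
theorem4p3 ℝ n 1≤n f f-stable d (high≈0 , _) =
  inversion-exists d f high≈0 , λ g → inversion-psdStable {d = d} {f} {g} f-stable
  where
  open ComplexNumbers ℝ
  open PolynomialFunctions complex
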